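{- Let $\mathcal{H}$ be the family of Halin graphs. Then $\frac{7}{6}\le \rho(\mathcal{H})\le \frac{3}{2}$.
   Context: All graphs are finite, simple and undirected. A vertex cover of $G=(V,E)$ is a set $S\subseteq V$ meeting every edge; $\mathrm{mvc}(G)$ is the minimum size of a vertex cover. Eternal vertex cover: a configuration is a vertex cover $C\subseteq V$, viewed as the set of positions of guards (at most one guard per vertex). When an edge $uv$ is attacked, the defender reconfigures $C$ to a new configuration $C'$ by moving all guards simultaneously: every guard stays or moves to an adjacent vertex, and some guard on $u$ or $v$ must move along the edge $uv$ to its other endpoint. That is, there is a bijection $\varphi:C\to C'$ with $\varphi(w)=w$ or $\varphi(w)$ adjacent to $w$ for all $w\in C$, and such that $u\in C,\varphi(u)=v$ or $v\in C,\varphi(v)=u$. An eternal vertex cover class of $G$ is a nonempty set of configurations, all of the same cardinality (called the size of the class), such that for every configuration $C$ in the class and every edge $uv$, an attack on $uv$ can be answered by reconfiguring $C$ to some configuration in the class. The eternal vertex cover number $\mathrm{evc}(G)$ is the minimum number $k$ of guards that can defend any infinite sequence of edge attacks, i.e. the minimum size of an eternal vertex cover class. For an infinite family $\mathcal{F}$ of graphs, $\rho(\mathcal{F})=\sup\{r\in\mathbb{R} : \text{for infinitely many (pairwise non-isomorphic) graphs } G\in\mathcal{F},\ \frac{\mathrm{evc}(G)}{\mathrm{mvc}(G)}\ge r\}$. A Halin graph is obtained from a tree $T$ with no vertex of degree two (and at least three leaves), embedded in the plane, by connecting all leaves of $T$ to form a cycle $C$ in the cyclic order induced by the planar embedding.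 -}

module Defs where

open import Level using (Level; 0ℓ; _⊔_) renaming (suc to lsuc)
open import Data.Nat using (ℕ; _≤_; _≟_; NonZero)
open import Data.Nat.GeneralisedArithmetic using (fold)
open import Data.Integer using (+_)
open import Data.Rational as ℚ using (ℚ; 0ℚ; 1ℚ)
import Data.Rational.Properties as ℚ
open import Data.Fin using (Fin)
open import Data.Fin.Subset using (Subset; _∈_; ∣_∣)
open import Data.List using (List; []; _∷_; _++_; length; filter; allFin)
open import Data.List.Relation.Unary.All using (All)
open import Data.List.Relation.Unary.Linked using (Linked)
open import Data.List.Relation.Unary.Unique.Propositional using (Unique)
open import Data.Product using (Σ; ∃; ∃-syntax; _×_; _,_)
open import Data.Sum using (_⊎_)
open import Function.Bundles using (_↔_; _⇔_; Inverse)
open import Relation.Binary using (Rel; Decidable; Symmetric; Irreflexive)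
open import Relation.Binary.Construct.Closure.ReflexiveTransitive using (Star)
open import Relation.Binary.PropositionalEquality using (_≡_; refl; subst)
open import Relation.Nullary using (¬_)
open import Relation.Unary using (Pred; _⊆_)

------------------------------------------------------------------------
-- Finite simple graphs

record Graph (n : ℕ) : Set₁ where
  field
    Adj    : Rel (Fin n) 0ℓ
    adj?   : Decidable Adj
    sym    : Symmetric Adj
    irrefl : Irreflexive _≡_ Adj

  degree : Fin n → ℕ
  degree v = length (filter (adj? v) (allFin n))

open Graph using (Adj; degree)

FinGraph : Set₁
FinGraph = ∃ Graph

_≅_ : FinGraph → FinGraph → Set
(m , G) ≅ (n , H) =
  Σ (Fin m ↔ Fin n) λ f →
    ∀ u v → Adj G u v ⇔ Adj H (Inverse.to f u) (Inverse.to f v)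

IsMinimum : ∀ {ℓ} → Pred ℕ ℓ → ℕ → Set ℓ
IsMinimum P k = P k × (∀ j → P j → k ≤ j)

module _ {n : ℕ} (G : Graph n) where

  VertexCover : Subset n → Set
  VertexCover S = ∀ u v → Adj G u v → u ∈ S ⊎ v ∈ S

  -- k is mvc(G)
  IsMvc : ℕ → Set
  IsMvc = IsMinimum λ k → ∃[ S ] VertexCover S × ∣ S ∣ ≡ k

  -- C can be reconfigured to C′ in response to an attack on the edge uv.
  -- The bijection C → C′ is the restriction to C of a map on all vertices,
  -- whose values outside C are immaterial.
  record Defence (C C′ : Subset n) (u v : Fin n) : Set where
    field
      φ          : Fin n → Fin n
      into       : ∀ {w} → w ∈ C → φ w ∈ C′
      injective  : ∀ {w x} → w ∈ C → x ∈ C → φ w ≡ φ x → w ≡ x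
      surjective : ∀ {y} → y ∈ C′ → ∃[ w ] w ∈ C × φ w ≡ y
      moves      : ∀ {w} → w ∈ C → φ w ≡ w ⊎ Adj G w (φ w)
      repels     : (u ∈ C × φ u ≡ v) ⊎ (v ∈ C × φ v ≡ u)

  record EvcClass (k : ℕ) (𝒞 : Pred (Subset n) 0ℓ) : Set where
    field
      nonempty : ∃[ C ] 𝒞 C
      covers   : ∀ {C} → 𝒞 C → VertexCover C
      size     : ∀ {C} → 𝒞 C → ∣ C ∣ ≡ k
      defends  : ∀ {C} → 𝒞 C → ∀ u v → Adj G u v →
                 ∃[ C′ ] 𝒞 C′ × Defence C C′ u v

  -- k is evc(G)
  IsEvc : ℕ → Set₁
  IsEvc = IsMinimum λ k → ∃[ 𝒞 ] EvcClass k 𝒞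

------------------------------------------------------------------------
-- Halin graphs

module _ {n : ℕ} (T : Graph n) where

  Connected : Set
  Connected = ∀ u v → Star (Adj T) u v

  -- The cycle v , vs₀ , … , vsₖ , v
  IsCycle : Fin n → List (Fin n) → Set
  IsCycle v vs =
    2 ≤ length vs × Unique (v ∷ vs) × Linked (Adj T) (v ∷ vs ++ v ∷ [])

  -- The graph with no vertices is also let through here; it has no leaves,
  -- so the condition on the number of leaves excludes it below.
  IsTree : Set
  IsTree = Connected × (∀ v vs → ¬ IsCycle v vs)

  Leaf : Fin n → Set
  Leaf v = degree T v ≡ 1

  leaves : List (Fin n)
  leaves = filter (λ v → degree T v ≟ 1) (allFin n)

  -- A rotation system: next v cyclically permutes the neighbours of v
  -- (transitivity on this finite set forces next v to be a single cycle on
  -- it). Embeddings in an oriented surface are, up to homeomorphism, the same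
  -- as rotation systems of a connected graph, and for a tree the surface is
  -- always the sphere. Values of next v at non-neighbours of v are immaterial.
  record PlaneEmbedding : Set where
    field
      next   : Fin n → Fin n → Fin n
      closed : ∀ {v u} → Adj T v u → Adj T v (next v u)
      cyclic : ∀ {v u w} → Adj T v u → Adj T v w →
               ∃[ k ] fold u (next v) k ≡ w

  module _ (E : PlaneEmbedding) where
    open PlaneEmbedding E

    -- Walking along the boundary of the unique face, having just traversed the
    -- edge from u to v, the first leaf met (v included) is w.
    data FirstLeaf : (u v w : Fin n) → Set where
      here  : ∀ {u v} → Leaf v → FirstLeaf u v v
      there : ∀ {u v w} → ¬ Leaf v → FirstLeaf v (next v u) w →
              FirstLeaf u v w

    -- w follows the leaf u in the cyclic order of the leaves.
    NextLeaf : Fin n → Fin n → Set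
    NextLeaf u w = Leaf u × ∃[ v ] Adj T u v × FirstLeaf u v w

record IsHalin {n : ℕ} (G : Graph n) : Set₁ where
  field
    T           : Graph n
    tree        : IsTree T
    noDegree2   : ∀ v → ¬ (degree T v ≡ 2)
    threeLeaves : 3 ≤ length (leaves T)
    embedding   : PlaneEmbedding T
    edges       : ∀ u v → Adj G u v ⇔
                  (Adj T u v ⊎ NextLeaf T embedding u v ⊎ NextLeaf T embedding v u)

Halin : Pred FinGraph (lsuc 0ℓ)
Halin (_ , G) = IsHalin G

------------------------------------------------------------------------
-- Real numbers, as (lower) Dedekind cuts: x corresponds to {q ∈ ℚ : q < x}

record ℝ : Set₁ where
  field
    cut       : Pred ℚ 0ℓ
    inhabited : ∃[ q ] cut q
    bounded   : ∃[ q ] ¬ cut q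
    downward  : ∀ {p q} → p ℚ.< q → cut q → cut p
    open-up   : ∀ {p} → cut p → ∃[ q ] p ℚ.< q × cut q

open ℝ using (cut)

fromℚ : ℚ → ℝ
fromℚ x = record
  { cut       = ℚ._< x
  ; inhabited = x ℚ.- 1ℚ , subst (x ℚ.- 1ℚ ℚ.<_) (ℚ.+-identityʳ x)
                  (ℚ.+-monoʳ-< x (ℚ.negative⁻¹ (ℚ.- 1ℚ)))
  ; bounded   = x , ℚ.<-irrefl refl
  ; downward  = ℚ.<-trans
  ; open-up   = λ p<x → let (q , p<q , q<x) = ℚ.<-dense p<x in q , p<q , q<x
  }

_≤ᵣ_ : ℝ → ℝ → Set
x ≤ᵣ y = cut x ⊆ cut y

-- Extended reals, including ±∞ (the full and the empty cut), since a
-- supremum need not be finite. They are ordered by inclusion of cuts.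
ExtReal : (ℓ : Level) → Set (lsuc ℓ)
ExtReal ℓ = Pred ℚ ℓ

rational : ℚ → ExtReal 0ℓ
rational x = cut (fromℚ x)

_≤ₑ_ : ∀ {a b} → ExtReal a → ExtReal b → Set (a ⊔ b)
x ≤ₑ y = x ⊆ y

sup : ∀ {ℓ} → Pred ℝ ℓ → ExtReal (lsuc 0ℓ ⊔ ℓ)
sup S q = ∃[ r ] S r × cut r q

------------------------------------------------------------------------
-- The ratio ρ

-- evc(G) / mvc(G) ≥ r; the quotient is undefined when mvc(G) = 0.
RatioAtLeast : ℝ → FinGraph → Set₁
RatioAtLeast r (_ , G) =
  ∃[ k ] ∃[ m ] IsEvc G k × IsMvc G m ×
    Σ (NonZero m) λ m≢0 → r ≤ᵣ fromℚ (ℚ._/_ (+ k) m {{m≢0}})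

-- Infinitely many pairwise non-isomorphic graphs satisfy P: no finite list
-- exhausts them up to isomorphism.
InfinitelyMany : ∀ {ℓ} → Pred FinGraph ℓ → Set (lsuc 0ℓ ⊔ ℓ)
InfinitelyMany P = ∀ (Gs : List FinGraph) → ∃[ G ] P G × All (λ H → ¬ (G ≅ H)) Gs

ρ : ∀ {ℓ} → Pred FinGraph ℓ → ExtReal (lsuc 0ℓ ⊔ ℓ)
ρ ℱ = sup λ r → InfinitelyMany λ G → ℱ G × RatioAtLeast r G

{-# OPTIONS --safe #-}
module Submission where

-- Upper bound. Let S be a minimum vertex cover of a Halin graph with tree T, and
-- let U consist of S and the internal vertices of T. Every internal vertex
-- outside S has at least two children in T, all of them in S, so 2|U| ≤ 3|S|.
-- Any two vertices are joined by a path of T with interior in U, so |U| + 1 guards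
-- suffice: one guard roams outside U, and an attack is answered by sliding the
-- guards along such a path. Hence 2 evc ≤ 3 mvc + 2, and the additive constant
-- does not matter since only finitely many Halin graphs have a given mvc.
--
-- Lower bound. Attach g copies of a ten-vertex gadget to a common root. A gadget
-- has a unique minimum vertex cover, of size 5, which admits an attack that cannot
-- be answered whatever happens outside the gadget. So evc ≥ 6g, while
-- mvc ≤ 5g + 1, and 6g / (5g + 1) ≥ 7/6 as soon as g ≥ 7.

open import Defs
open import Data.Bool using (Bool; true; false)
import Data.Bool.Properties as Bool
open import Data.Empty using (⊥; ⊥-elim)
open import Data.Fin as Fin using (Fin; zero; suc; toℕ; combine; remQuot)
import Data.Fin.Induction as Fin
import Data.Fin.Permutation as Perm
import Data.Fin.Relation.Unary.Top as Top
import Data.Fin.Properties as Fin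
open import Data.Fin.Subset using (Subset; _∈_; _∉_; ∣_∣; inside; outside; _∪_; ⊤; ⁅_⁆; ∁)
open import Data.Fin.Subset.Properties using (_∈?_; ∈⊤)
import Data.Fin.Subset.Properties as Sub
open import Data.Integer as ℤ using (+_)
import Data.Integer.Properties as ℤ
open import Data.List using (List; []; _∷_; _++_; length; map; filter; concatMap; allFin; cartesianProductWith; upTo)
import Data.List.Properties as List
import Data.List.Membership.Propositional as L
import Data.List.Membership.Propositional.Properties as L
open import Data.List.Relation.Unary.All as All using (All; []; _∷_)
import Data.List.Relation.Unary.All.Properties as All
open import Data.List.Relation.Unary.AllPairs using ([]; _∷_)
open import Data.List.Relation.Unary.Any as Any using (Any; here; there)
open import Data.List.Relation.Unary.Linked using (Linked; []; [-]; _∷_)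
open import Data.List.Relation.Unary.Unique.Propositional using (Unique)
import Data.List.Relation.Unary.Unique.Propositional.Properties as Unique
open import Data.Maybe using (Maybe; just; nothing)
import Data.Maybe.Properties as Maybe
open import Data.Nat using (ℕ; zero; suc; _+_; _*_; _≤_; _<_; z≤n; s≤s; NonZero)
import Data.Nat.Properties as ℕ
open import Data.Nat.GeneralisedArithmetic using (fold)
open import Data.Nat.Solver using (module +-*-Solver)
open import Data.Product using (Σ; ∃; ∃-syntax; ∃₂; _×_; _,_; proj₁; proj₂; uncurry)
open import Data.Rational as ℚ using (ℚ; _/_)
import Data.Rational.Properties as ℚ
import Data.Rational.Unnormalised as ℚᵘ
import Data.Rational.Unnormalised.Properties as ℚᵘ
open import Data.Sum as Sum using (_⊎_; inj₁; inj₂; [_,_]′)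
open import Data.Vec as Vec using (Vec; []; _∷_; lookup; tabulate)
import Data.Vec.Properties as Vec
open import Function using (_∘_; id; case_of_)
open import Function.Bundles using (_⇔_; Equivalence; mk⇔)
open import Level using (0ℓ)
open import Relation.Binary using (Rel; Symmetric)
open import Relation.Binary.Construct.Closure.ReflexiveTransitive using (Star; ε; _◅_; _◅◅_)
import Relation.Binary.Construct.Closure.ReflexiveTransitive as Star
open import Relation.Binary.PropositionalEquality using (_≡_; _≢_; refl; sym; trans; cong; cong₂; subst; subst₂)
open import Relation.Nullary using (¬_; Dec; yes; no; contradiction; _×-dec_; _⊎-dec_; _→-dec_; ¬?; does)
import Relation.Nullary.Decidable as Dec
open import Relation.Nullary.Decidable using (from-yes; from-no)
open import Relation.Unary using (Pred)

open Graph using (Adj; adj?; degree)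

-- Cardinalities

-- The gadget is built around two disjoint triangles, p₀ℓ₃ℓ₄ and q₀ℓ₅ℓ₆. A vertex cover needs two
-- guards in each, but after the critical attack only three guards can be there. Guards from outside
-- enter a gadget at b₀ or ℓ₁ or ℓ₇; of these none is on a triangle, so outside help is one move
-- late and the bound adds up over gadgets. The gap between 6/5 and 7/6 pays for the root. The lower
-- bound also has to exhibit the exact values of evc and mvc. An eternal class is an arbitrary
-- predicate on configurations, so the existence of a least size rests on deciding whether a class
-- of a given size exists, by a greatest fixed point over the finitely many vertex covers of that
-- size. For the upper bound, "infinitely many" means that no finite list exhausts the graphs, so
-- finiteness is shown by producing a list. The order is bounded in terms of mvc through the
-- rotation system: a leaf outside U is recovered from its neighbour in T and the preceding vertex
-- around that neighbour. All graphs up to that order are listed through their adjacency matrices.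

module _ {A : Set} where

  unique⊆⇒length≤ : ∀ {xs ys : List A} → Unique xs → (∀ {x} → x L.∈ xs → x L.∈ ys) →
                    length xs ≤ length ys
  unique⊆⇒length≤ {[]}     _           _  = z≤n
  unique⊆⇒length≤ {x ∷ xs} (x∉xs ∷ xs!) ⊆ys with L.∈-∃++ (⊆ys (here refl))
  ... | ps , qs , refl = begin
    suc (length xs)         ≤⟨ s≤s (unique⊆⇒length≤ xs! ⊆ps++qs) ⟩
    suc (length (ps ++ qs)) ≡⟨ sym (List.length-++-sucʳ ps _ qs) ⟩
    length (ps ++ x ∷ qs)   ∎
    where
    open ℕ.≤-Reasoning
    ⊆ps++qs : ∀ {y} → y L.∈ xs → y L.∈ ps ++ qs
    ⊆ps++qs y∈xs with L.∈-++⁻ ps (⊆ys (there y∈xs))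
    ... | inj₁ y∈ps         = L.∈-++⁺ˡ y∈ps
    ... | inj₂ (here refl)  = contradiction refl (All.lookup x∉xs y∈xs)
    ... | inj₂ (there y∈qs) = L.∈-++⁺ʳ ps y∈qs

members : ∀ {n} → Subset n → List (Fin n)
members []          = []
members (true ∷ S)  = zero ∷ map suc (members S)
members (false ∷ S) = map suc (members S)

length-members : ∀ {n} (S : Subset n) → length (members S) ≡ ∣ S ∣
length-members []          = refl
length-members (true ∷ S)  = cong suc (trans (List.length-map suc (members S)) (length-members S))
length-members (false ∷ S) = trans (List.length-map suc (members S)) (length-members S)

∈-members⁺ : ∀ {n} {S : Subset n} {x} → x ∈ S → x L.∈ members S
∈-members⁺ {S = true ∷ S}  Vec.here        = here refl
∈-members⁺ {S = true ∷ S}  (Vec.there x∈S) = there (L.∈-map⁺ suc (∈-members⁺ x∈S))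
∈-members⁺ {S = false ∷ S} (Vec.there x∈S) = L.∈-map⁺ suc (∈-members⁺ x∈S)

∈-members⁻ : ∀ {n} (S : Subset n) {x} → x L.∈ members S → x ∈ S
∈-members⁻ (true ∷ S)  (here refl) = Vec.here
∈-members⁻ (true ∷ S)  (there x∈) with L.∈-map⁻ suc x∈
... | _ , y∈ , refl = Vec.there (∈-members⁻ S y∈)
∈-members⁻ (false ∷ S) x∈ with L.∈-map⁻ suc x∈
... | _ , y∈ , refl = Vec.there (∈-members⁻ S y∈)

members-unique : ∀ {n} (S : Subset n) → Unique (members S)
members-unique []          = []
members-unique (true ∷ S)  = All.tabulate (λ x∈ 0≡x → case L.∈-map⁻ suc x∈ of λ where
                               (_ , _ , refl) → contradiction 0≡x λ ())
                             ∷ Unique.map⁺ Fin.suc-injective (members-unique S)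
members-unique (false ∷ S) = Unique.map⁺ Fin.suc-injective (members-unique S)

unique⇒length≤∣∣ : ∀ {n} {S : Subset n} {xs} → Unique xs → (∀ {x} → x L.∈ xs → x ∈ S) →
                   length xs ≤ ∣ S ∣
unique⇒length≤∣∣ {S = S} xs! xs⊆S =
  subst (_ ≤_) (length-members S) (unique⊆⇒length≤ xs! (∈-members⁺ ∘ xs⊆S))

⊆⇒∣∣≤length : ∀ {n} {S : Subset n} xs → (∀ {x} → x ∈ S → x L.∈ xs) → ∣ S ∣ ≤ length xs
⊆⇒∣∣≤length {S = S} xs S⊆xs =
  subst (_≤ _) (length-members S) (unique⊆⇒length≤ (members-unique S) (S⊆xs ∘ ∈-members⁻ S))

∉⇒∣p∪⁅x⁆∣≡1+∣p∣ : ∀ {n} {p : Subset n} {x} → x ∉ p → ∣ p ∪ ⁅ x ⁆ ∣ ≡ suc ∣ p ∣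
∉⇒∣p∪⁅x⁆∣≡1+∣p∣ {p = true ∷ p}  {zero}  x∉p = contradiction Vec.here x∉p
∉⇒∣p∪⁅x⁆∣≡1+∣p∣ {p = false ∷ p} {zero}  x∉p = cong (suc ∘ ∣_∣) (Sub.∪-identityʳ p)
∉⇒∣p∪⁅x⁆∣≡1+∣p∣ {p = true ∷ p}  {suc x} x∉p = cong suc (∉⇒∣p∪⁅x⁆∣≡1+∣p∣ (x∉p ∘ Vec.there))
∉⇒∣p∪⁅x⁆∣≡1+∣p∣ {p = false ∷ p} {suc x} x∉p = ∉⇒∣p∪⁅x⁆∣≡1+∣p∣ (x∉p ∘ Vec.there)

-- Finite searches

vecs : ∀ {A : Set} → List A → ∀ n → List (Vec A n)
vecs xs zero    = [] ∷ []
vecs xs (suc n) = cartesianProductWith _∷_ xs (vecs xs n)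

∈-vecs : ∀ {A : Set} {xs : List A} → (∀ x → x L.∈ xs) → ∀ {n} (v : Vec A n) → v L.∈ vecs xs n
∈-vecs complete []      = here refl
∈-vecs complete (x ∷ v) = L.∈-cartesianProductWith⁺ _∷_ (complete x) (∈-vecs complete v)

bools : List Bool
bools = true ∷ false ∷ []

∈-bools : ∀ b → b L.∈ bools
∈-bools true  = here refl
∈-bools false = there (here refl)

subsets : ∀ n → List (Subset n)
subsets = vecs bools

∈-subsets : ∀ {n} (S : Subset n) → S L.∈ subsets n
∈-subsets = ∈-vecs ∈-bools

_∈ₗ?_ : ∀ {n} (x : Fin n) (xs : List (Fin n)) → Dec (x L.∈ xs)
x ∈ₗ? xs = Any.any? (x Fin.≟_) xs

any∈? : ∀ {A : Set} {ℓ} {P : Pred A ℓ} → (∀ x → Dec (P x)) → ∀ {xs : List A} →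
        (∀ x → x L.∈ xs) → Dec (∃ P)
any∈? P? {xs} complete =
  Dec.map′ Any.satisfied (λ (x , px) → L.lose (complete x) px) (Any.any? P? xs)

least : ∀ {ℓ} {P : Pred ℕ ℓ} → (∀ k → Dec (P k)) → ∀ {k} → P k → ∃ (IsMinimum P)
least {P = P} P? {k} Pk = search k 0 (ℕ.+-identityʳ k) (λ _ _ → z≤n)
  where
  search : ∀ d i → d + i ≡ k → (∀ j → P j → i ≤ j) → ∃ (IsMinimum P)
  search zero    i refl min = i , Pk , min
  search (suc d) i eq min with P? i
  ... | yes Pi = i , Pi , min
  ... | no ¬Pi = search d (suc i) (trans (ℕ.+-suc d i) eq) λ j Pj →
    ℕ.≤∧≢⇒< (min j Pj) λ i≡j → ¬Pi (subst P (sym i≡j) Pj)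

-- Walks and degrees

data Walk {A : Set} (R : Rel A 0ℓ) : A → A → List A → Set where
  [-] : ∀ {a} → Walk R a a (a ∷ [])
  _∷_ : ∀ {a b c l} → R a b → Walk R b c l → Walk R a c (a ∷ l)

module _ {A : Set} {R : Rel A 0ℓ} where

  walk-map : ∀ {S : Rel A 0ℓ} {a b l} → (∀ {x y} → R x y → S x y) → Walk R a b l → Walk S a b l
  walk-map f [-]     = [-]
  walk-map f (r ∷ w) = f r ∷ walk-map f w

  start∈ : ∀ {a b l} → Walk R a b l → a L.∈ l
  start∈ [-]     = here refl
  start∈ (_ ∷ _) = here refl

  end∈ : ∀ {a b l} → Walk R a b l → b L.∈ l
  end∈ [-]     = here refl
  end∈ (_ ∷ w) = there (end∈ w)

  walk-snoc : ∀ {a b c l} → Walk R a b l → R b c → Walk R a c (l ++ c ∷ [])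
  walk-snoc [-]     s = s ∷ [-]
  walk-snoc (r ∷ w) s = r ∷ walk-snoc w s

  walk⇒linked : ∀ {a b c d l} → R c a → Walk R a b l → R b d → Linked R (c ∷ l ++ d ∷ [])
  walk⇒linked r [-]     s = r ∷ s ∷ [-]
  walk⇒linked r (q ∷ w) s = r ∷ walk⇒linked q w s

fresh : ∀ {A : Set} {x : A} {l} → ¬ (x L.∈ l) → All (x ≢_) l
fresh = All.¬Any⇒All¬ _

unique-snoc : ∀ {A : Set} {x : A} {l} → Unique l → ¬ (x L.∈ l) → Unique (l ++ x ∷ [])
unique-snoc l! x∉l = Unique.++⁺ l! ([] ∷ []) λ where (y∈l , here refl) → x∉l y∈l

three-distinct : ∀ {A : Set} {P : Pred A 0ℓ} xs → 3 ≤ length xs → Unique xs → (∀ {x} → x L.∈ xs → P x) →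
                 ∃[ a ] ∃[ b ] ∃[ c ] (a ≢ b × a ≢ c × b ≢ c) × P a × P b × P c
three-distinct (a ∷ b ∷ c ∷ _) _ ((a≢b ∷ a≢c ∷ _) ∷ (b≢c ∷ _) ∷ _) p =
  a , b , c , (a≢b , a≢c , b≢c) , p (here refl) , p (there (here refl)) , p (there (there (here refl)))
three-distinct (_ ∷ _ ∷ []) (s≤s (s≤s ())) _ _
three-distinct (_ ∷ [])     (s≤s ())       _ _

module _ {n : ℕ} (G : Graph n) where

  neighbours : Fin n → List (Fin n)
  neighbours v = filter (adj? G v) (allFin n)

  neighbours! : ∀ v → Unique (neighbours v)
  neighbours! v = Unique.filter⁺ (adj? G v) (Unique.allFin⁺ n)

  ∈-neighbours⁺ : ∀ {v u} → Adj G v u → u L.∈ neighbours v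
  ∈-neighbours⁺ {v} = L.∈-filter⁺ (adj? G v) (L.∈-allFin _)

  ∈-neighbours⁻ : ∀ {v u} → u L.∈ neighbours v → Adj G v u
  ∈-neighbours⁻ {v} = proj₂ ∘ L.∈-filter⁻ (adj? G v) {xs = allFin n}

  degree≡length : ∀ {v} {us} → Unique us → (∀ {u} → Adj G v u → u L.∈ us) →
                  (∀ {u} → u L.∈ us → Adj G v u) → degree G v ≡ length us
  degree≡length {v} us! ⊆us us⊆ = ℕ.≤-antisym
    (unique⊆⇒length≤ (neighbours! v) (⊆us ∘ ∈-neighbours⁻))
    (unique⊆⇒length≤ us! (∈-neighbours⁺ ∘ us⊆))

  leaf? : ∀ v → Dec (Leaf G v)
  leaf? v = degree G v ℕ.≟ 1

  leaf-neighbour-unique : ∀ {v u w} → Leaf G v → Adj G v u → Adj G v w → u ≡ w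
  leaf-neighbour-unique {v} leaf vu vw =
    singleton (neighbours v) leaf (∈-neighbours⁺ vu) (∈-neighbours⁺ vw)
    where
    singleton : ∀ {A : Set} {x y : A} xs → length xs ≡ 1 → x L.∈ xs → y L.∈ xs → x ≡ y
    singleton (_ ∷ []) _ (here refl) (here refl) = refl

  three-neighbours : ∀ {v} → 3 ≤ degree G v → ∃[ a ] ∃[ b ] ∃[ c ]
    (a ≢ b × a ≢ c × b ≢ c) × Adj G v a × Adj G v b × Adj G v c
  three-neighbours {v} 3≤ = three-distinct (neighbours v) 3≤ (neighbours! v) ∈-neighbours⁻

-- Trees

module _ {n : ℕ} (T : Graph n) (acyclic : ∀ v vs → ¬ IsCycle T v vs) where

  -- A tree is explored from a root; every newly reached vertex has exactly one
  -- neighbour among the earlier ones, which becomes its parent.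
  record Explored (W : List (Fin n)) : Set where
    field
      parent   : Fin n → Fin n
      oriented : ∀ {u v} → u L.∈ W → v L.∈ W → Adj T u v → parent u ≡ v ⊎ parent v ≡ u
      path     : ∀ {a b} → a L.∈ W → b L.∈ W →
                 ∃[ l ] Walk (Adj T) a b l × Unique l × (∀ {y} → y L.∈ l → y L.∈ W)

  open Explored

  explored-root : ∀ r → Explored (r ∷ [])
  -- A default: the root has no parent, and every vertex attached later receives its own value.
  explored-root r .parent = id
  explored-root r .oriented (here refl) (here refl) rr = contradiction rr (Graph.irrefl T refl)
  explored-root r .path (here refl) (here refl) = r ∷ [] , [-] , [] ∷ [] , id

  module _ {W : List (Fin n)} (E : Explored W) {a x : Fin n} (a∈W : a L.∈ W) (x∉W : ¬ x L.∈ W)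
           (ax : Adj T a x) where

    private
      -- A second explored neighbour `b` of `x` would close the path from `a` to `b` into a cycle
      -- through `x`; `two` supplies the minimal length of a cycle.
      attach-unique : ∀ {b} → b L.∈ W → Adj T b x → b ≡ a
      attach-unique {b} b∈W bx with b Fin.≟ a
      ... | yes b≡a = b≡a
      ... | no  b≢a with path E a∈W b∈W
      ... | l , w , l! , l⊆W = ⊥-elim (acyclic x l
        ( two w
        , fresh (x∉W ∘ l⊆W) ∷ l!
        , walk⇒linked (Graph.sym T ax) w bx))
        where
        two : ∀ {l} → Walk (Adj T) a b l → 2 ≤ length l
        two [-]           = contradiction refl b≢a
        two (_ ∷ [-])     = s≤s (s≤s z≤n)
        two (_ ∷ (_ ∷ _)) = s≤s (s≤s z≤n)

      parent′ : Fin n → Fin n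
      parent′ u with u Fin.≟ x
      ... | yes _ = a
      ... | no  _ = parent E u

      parent′-new : parent′ x ≡ a
      parent′-new with x Fin.≟ x
      ... | yes _   = refl
      ... | no  x≢x = contradiction refl x≢x

      parent′-old : ∀ {u} → u L.∈ W → parent′ u ≡ parent E u
      parent′-old {u} u∈W with u Fin.≟ x
      ... | yes refl = contradiction u∈W x∉W
      ... | no  _    = refl

    explored-extend : Explored (x ∷ W)
    explored-extend .parent = parent′
    explored-extend .oriented (here refl) (here refl) xx = contradiction xx (Graph.irrefl T refl)
    explored-extend .oriented (here refl) (there v∈W) xv =
      inj₁ (trans parent′-new (sym (attach-unique v∈W (Graph.sym T xv))))
    explored-extend .oriented (there u∈W) (here refl) ux =
      inj₂ (trans parent′-new (sym (attach-unique u∈W ux)))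
    explored-extend .oriented (there u∈W) (there v∈W) uv =
      Sum.map (trans (parent′-old u∈W)) (trans (parent′-old v∈W)) (oriented E u∈W v∈W uv)
    explored-extend .path (here refl) (here refl) = x ∷ [] , [-] , [] ∷ [] , λ { (here refl) → here refl }
    explored-extend .path (here refl) (there b∈W) with path E a∈W b∈W
    ... | l , w , l! , l⊆W = x ∷ l , Graph.sym T ax ∷ w , fresh (x∉W ∘ l⊆W) ∷ l! ,
      λ { (here refl) → here refl ; (there y∈l) → there (l⊆W y∈l) }
    explored-extend .path (there b∈W) (here refl) with path E b∈W a∈W
    ... | l , w , l! , l⊆W = l ++ x ∷ [] , walk-snoc w ax , unique-snoc l! (x∉W ∘ l⊆W) ,
      λ y∈ → case L.∈-++⁻ l y∈ of λ where
        (inj₁ y∈l)         → there (l⊆W y∈l)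
        (inj₂ (here refl)) → here refl
    explored-extend .path (there b∈W) (there c∈W) with path E b∈W c∈W
    ... | l , w , l! , l⊆W = l , w , l! , there ∘ l⊆W

  explored-reach : ∀ {W a u} → Explored W → a L.∈ W → Star (Adj T) a u →
                   ∃[ W′ ] Explored W′ × (∀ {y} → y L.∈ W → y L.∈ W′) × u L.∈ W′
  explored-reach {W} E a∈W ε = W , E , id , a∈W
  explored-reach {W} E a∈W (_◅_ {j = x} ax xs) with x ∈ₗ? W
  ... | yes x∈W = explored-reach E x∈W xs
  ... | no  x∉W with explored-reach (explored-extend E a∈W x∉W ax) (here refl) xs
  ... | W′ , E′ , ⊆W′ , u∈W′ = W′ , E′ , ⊆W′ ∘ there , u∈W′

  explored-all : Connected T → Fin n → ∃[ W ] Explored W × (∀ u → u L.∈ W)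
  explored-all connected r with go (allFin n)
    where
    go : ∀ us → ∃[ W ] Explored W × r L.∈ W × All (L._∈ W) us
    go []       = r ∷ [] , explored-root r , here refl , []
    go (u ∷ us) with go us
    ... | W , E , r∈W , us⊆W with explored-reach E r∈W (connected r u)
    ... | W′ , E′ , ⊆W′ , u∈W′ = W′ , E′ , ⊆W′ r∈W , u∈W′ ∷ All.map ⊆W′ us⊆W
  ... | W , E , _ , all⊆W = W , E , λ u → All.lookup all⊆W (L.∈-allFin u)

module _ {n : ℕ} (T : Graph n) where

  -- A vertex before the end of the walk is adjacent to its predecessor and its successor, which
  -- differ because the list is `Unique`, whereas a leaf has only one neighbour. `p` is the
  -- predecessor of the first vertex.
  interior-not-leaf : ∀ {p a b l y} → Adj T p a → Walk (Adj T) a b l →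
                      Unique (p ∷ l) → y L.∈ l → y ≡ b ⊎ ¬ Leaf T y
  interior-not-leaf pa [-]       _        (here refl) = inj₁ refl
  interior-not-leaf pa (aa′ ∷ w) (p≢ ∷ _) (here refl) = inj₂ λ leaf →
    All.lookup p≢ (there (start∈ w)) (leaf-neighbour-unique T leaf (Graph.sym T pa) aa′)
  interior-not-leaf pa (aa′ ∷ w) (_ ∷ l!) (there y∈l) = interior-not-leaf aa′ w l! y∈l

-- Guards sliding along a path

module _ {n : ℕ} where

  transpose : Fin n → Fin n → Fin n → Fin n
  transpose a b w with w Fin.≟ a
  ... | yes _ = b
  ... | no  _ with w Fin.≟ b
  ...   | yes _ = a
  ...   | no  _ = w

  transpose-left : ∀ a b → transpose a b a ≡ b
  transpose-left a b with a Fin.≟ a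
  ... | yes _   = refl
  ... | no  a≢a = contradiction refl a≢a

  transpose-right : ∀ a b → transpose a b b ≡ a
  transpose-right a b with b Fin.≟ a
  ... | yes b≡a = b≡a
  ... | no  _ with b Fin.≟ b
  ...   | yes _   = refl
  ...   | no  b≢b = contradiction refl b≢b

  transpose-other : ∀ {a b w} → w ≢ a → w ≢ b → transpose a b w ≡ w
  transpose-other {a} {b} {w} w≢a w≢b with w Fin.≟ a
  ... | yes w≡a = contradiction w≡a w≢a
  ... | no  _ with w Fin.≟ b
  ...   | yes w≡b = contradiction w≡b w≢b
  ...   | no  _   = refl

  transpose-involutive : ∀ a b w → transpose a b (transpose a b w) ≡ w
  transpose-involutive a b w with w Fin.≟ a
  ... | yes refl = transpose-right a b
  ... | no  w≢a with w Fin.≟ b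
  ...   | yes refl = transpose-left a b
  ...   | no  w≢b = transpose-other w≢a w≢b

  -- The cyclic permutation taking each vertex of a list to its predecessor.
  slide : List (Fin n) → Fin n → Fin n
  slide (a ∷ b ∷ l) w = slide (b ∷ l) (transpose a b w)
  slide _           w = w

  unslide : List (Fin n) → Fin n → Fin n
  unslide (a ∷ b ∷ l) w = transpose a b (unslide (b ∷ l) w)
  unslide _           w = w

  slide-unslide : ∀ l w → slide l (unslide l w) ≡ w
  slide-unslide []          w = refl
  slide-unslide (a ∷ [])    w = refl
  slide-unslide (a ∷ b ∷ l) w = trans (cong (slide (b ∷ l)) (transpose-involutive a b _))
                                      (slide-unslide (b ∷ l) w)

  unslide-slide : ∀ l w → unslide l (slide l w) ≡ w
  unslide-slide []          w = refl
  unslide-slide (a ∷ [])    w = refl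
  unslide-slide (a ∷ b ∷ l) w = trans (cong (transpose a b) (unslide-slide (b ∷ l) _))
                                      (transpose-involutive a b w)

  slide-injective : ∀ l {w x} → slide l w ≡ slide l x → w ≡ x
  slide-injective l {w} {x} eq =
    trans (sym (unslide-slide l w)) (trans (cong (unslide l) eq) (unslide-slide l x))

  slide-outside : ∀ l {w} → ¬ w L.∈ l → slide l w ≡ w
  slide-outside []          w∉ = refl
  slide-outside (a ∷ [])    w∉ = refl
  slide-outside (a ∷ b ∷ l) w∉ =
    trans (cong (slide (b ∷ l)) (transpose-other (λ w≡a → w∉ (here w≡a)) (λ w≡b → w∉ (there (here w≡b)))))
          (slide-outside (b ∷ l) (w∉ ∘ there))

  slide-second : ∀ {a b l} → Unique (a ∷ b ∷ l) → slide (a ∷ b ∷ l) b ≡ a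
  slide-second {a} {b} {l} (a≢ ∷ _) = trans (cong (slide (b ∷ l)) (transpose-right a b))
    (slide-outside (b ∷ l) (λ a∈ → All.lookup a≢ a∈ refl))

  slide-start : ∀ {R : Rel (Fin n) 0ℓ} {a z l} → Walk R a z l → slide l a ≡ z
  slide-start [-]                             = refl
  slide-start {a = a} (_ ∷ [-] {b})           = transpose-left a b
  slide-start {a = a} (_ ∷ w@(_∷_ {b} {l = l} _ _)) =
    trans (cong (slide (b ∷ l)) (transpose-left a b)) (slide-start w)

  slide-moves : ∀ {R : Rel (Fin n) 0ℓ} {a z l} → Symmetric R → Walk R a z l → Unique l →
                ∀ {w} → w L.∈ l → w ≢ a → R w (slide l w) × slide l w L.∈ l
  slide-moves R-sym [-]     _  (here refl) w≢a = contradiction refl w≢a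
  slide-moves R-sym (_ ∷ _) _  (here refl) w≢a = contradiction refl w≢a
  slide-moves {R} {a} R-sym (_∷_ {b = b} {l = l} r w) l!@(_ ∷ l′!) {v} (there v∈) v≢a with v Fin.≟ b | w
  ... | yes refl | [-] = subst (R v) (sym (slide-second l!)) (R-sym r) , here (slide-second l!)
  ... | yes refl | _ ∷ _ = subst (R v) (sym (slide-second l!)) (R-sym r) , here (slide-second l!)
  ... | no  v≢b  | [-] = contradiction (case v∈ of λ { (here v≡b) → v≡b }) v≢b
  ... | no  v≢b  | w@(_ ∷ _) with slide-moves R-sym w l′! v∈ v≢b
  ... | rv , sv∈ rewrite transpose-other {a} {b} v≢a v≢b = rv , there sv∈

module _ {n : ℕ} (G : Graph n) where

  defence-flip : ∀ {C C′ u v} → Defence G C C′ u v → Defence G C C′ v u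
  defence-flip D = record
    { φ = φ ; into = into ; injective = injective ; surjective = surjective ; moves = moves
    ; repels = Sum.swap repels }
    where open Defence D

  -- The two guards exchange places, so the configuration stays the same.
  defence-swap : ∀ {C u v} → u ∈ C → v ∈ C → Adj G u v → Defence G C C u v
  defence-swap {C} {u} {v} u∈C v∈C uv = record
    { φ          = transpose u v
    ; into       = into
    ; injective  = λ {w} {x} _ _ eq →
        trans (sym (transpose-involutive u v w))
          (trans (cong (transpose u v) eq) (transpose-involutive u v x))
    ; surjective = λ {y} y∈C → transpose u v y , into y∈C , transpose-involutive u v y
    ; moves      = λ {w} _ → moves w
    ; repels     = inj₁ (u∈C , transpose-left u v)
    }
    where
    into : ∀ {w} → w ∈ C → transpose u v w ∈ C
    into {w} w∈C with w Fin.≟ u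
    ... | yes _ = v∈C
    ... | no  _ with w Fin.≟ v
    ...   | yes _ = u∈C
    ...   | no  _ = w∈C
    moves : ∀ w → transpose u v w ≡ w ⊎ Adj G w (transpose u v w)
    moves w with w Fin.≟ u
    ... | yes refl = inj₂ uv
    ... | no  _ with w Fin.≟ v
    ...   | yes refl = inj₂ (Graph.sym G uv)
    ...   | no  _    = inj₁ refl

  module _ {U : Subset n} where

    ∈-add⁻ : ∀ {x y} → y ∈ U ∪ ⁅ x ⁆ → y ∈ U ⊎ y ≡ x
    ∈-add⁻ {x} = Sum.map₂ (Sub.x∈⁅y⁆⇒x≡y x) ∘ Sub.x∈p∪q⁻ U ⁅ x ⁆

    ∈-add⁺ : ∀ {x y} → y ∈ U ⊎ y ≡ x → y ∈ U ∪ ⁅ x ⁆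
    ∈-add⁺ (inj₁ y∈U)  = Sub.x∈p∪q⁺ (inj₁ y∈U)
    ∈-add⁺ (inj₂ refl) = Sub.x∈p∪q⁺ (inj₂ (Sub.x∈⁅x⁆ _))

    -- All of `l` is occupied and `v` is free, so every guard on `l` steps to its predecessor in
    -- `v ∷ l`: `u` enters `v`, and `x` becomes free. Being a permutation of all vertices, the slide
    -- has an inverse; its one jump, from `v` to `x`, moves no guard.
    defence-slide : ∀ {x u v l} → u ∈ U → x ∉ U → v ∉ U → v ≢ x → Adj G u v →
                    Walk (Adj G) u x l → Unique l → (∀ {y} → y L.∈ l → y ∈ U ⊎ y ≡ x) →
                    Defence G (U ∪ ⁅ x ⁆) (U ∪ ⁅ v ⁆) u v
    defence-slide {x} {u} {v} {l} u∈U x∉U v∉U v≢x uv w l! l⊆ = record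
      { φ          = φ
      ; into       = ∈-add⁺ ∘ into ∘ ∈-add⁻
      ; injective  = λ _ _ → slide-injective path
      ; surjective = λ {y} y∈ → unslide path y , ∈-add⁺ (back (∈-add⁻ y∈)) , slide-unslide path y
      ; moves      = moves ∘ ∈-add⁻
      ; repels     = inj₁ (∈-add⁺ (inj₁ u∈U) , u↦v w path!)
      }
      where
      path = v ∷ l
      φ = slide path

      v∉l : ¬ v L.∈ l
      v∉l v∈l with l⊆ v∈l
      ... | inj₁ v∈U = v∉U v∈U
      ... | inj₂ v≡x = v≢x v≡x

      path! : Unique path
      path! = fresh v∉l ∷ l!

      walk : Walk (Adj G) v x path
      walk = Graph.sym G uv ∷ w

      u↦v : ∀ {l} → Walk (Adj G) u x l → Unique (v ∷ l) → slide (v ∷ l) u ≡ v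
      u↦v [-]     vl! = slide-second vl!
      u↦v (_ ∷ _) vl! = slide-second vl!

      ≢v : ∀ {y} → y ∈ U ⊎ y ≡ x → y ≢ v
      ≢v (inj₁ y∈U) refl = v∉U y∈U
      ≢v (inj₂ y≡x) refl = v≢x y≡x

      into : ∀ {y} → y ∈ U ⊎ y ≡ x → φ y ∈ U ⊎ φ y ≡ v
      into {y} y∈ with y ∈ₗ? path
      ... | no y∉ rewrite slide-outside path y∉ =
        Sum.map₂ (λ { refl → contradiction (end∈ walk) y∉ }) y∈
      ... | yes y∈path with proj₂ (slide-moves (Graph.sym G) walk path! y∈path (≢v y∈))
      ... | here eq = inj₂ eq
      ... | there φy∈l with l⊆ φy∈l
      ... | inj₁ φy∈U = inj₁ φy∈U
      ... | inj₂ φy≡x = contradiction (slide-injective path (trans φy≡x (sym (slide-start walk)))) (≢v y∈)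

      back : ∀ {y} → y ∈ U ⊎ y ≡ v → unslide path y ∈ U ⊎ unslide path y ≡ x
      back {y} y∈ with unslide path y ∈ₗ? path | slide-unslide path y
      ... | no z∉ | eq = inj₁ (subst (_∈ U) y≡z (case y∈ of λ where
                (inj₁ y∈U)  → y∈U
                (inj₂ refl) → contradiction (here (sym y≡z)) z∉))
        where y≡z = trans (sym eq) (slide-outside path z∉)
      ... | yes (there z∈l) | _ = l⊆ z∈l
      ... | yes (here z≡v) | eq = contradiction
        (trans (sym eq) (trans (cong φ z≡v) (slide-start walk)))
        λ y≡x → case y∈ of λ where
          (inj₁ y∈U) → x∉U (subst (_∈ U) y≡x y∈U)
          (inj₂ y≡v) → v≢x (trans (sym y≡v) y≡x)

      moves : ∀ {y} → y ∈ U ⊎ y ≡ x → φ y ≡ y ⊎ Adj G y (φ y)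
      moves {y} y∈ with y ∈ₗ? path
      ... | no y∉      = inj₁ (slide-outside path y∉)
      ... | yes y∈path = inj₂ (proj₁ (slide-moves (Graph.sym G) walk path! y∈path (≢v y∈)))

  module _ {U : Subset n} (cover : VertexCover G U)
           (connected : ∀ {u x} → u ∈ U → x ∉ U → ∃[ l ]
              Walk (Adj G) u x l × Unique l × (∀ {y} → y L.∈ l → y ∈ U ⊎ y ≡ x)) where

    roaming-class : ∀ {x} → x ∉ U → EvcClass G (suc ∣ U ∣) (λ C → ∃[ x ] x ∉ U × C ≡ U ∪ ⁅ x ⁆)
    roaming-class {x₀} x₀∉U = record
      { nonempty = U ∪ ⁅ x₀ ⁆ , x₀ , x₀∉U , refl
      ; covers   = covers
      ; size     = λ { (x , x∉U , refl) → ∉⇒∣p∪⁅x⁆∣≡1+∣p∣ x∉U }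
      ; defends  = defends
      }
      where
      𝒞 = λ C → ∃[ x ] x ∉ U × C ≡ U ∪ ⁅ x ⁆

      covers : ∀ {C} → 𝒞 C → VertexCover G C
      covers (x , _ , refl) u v uv = Sum.map (∈-add⁺ ∘ inj₁) (∈-add⁺ ∘ inj₁) (cover u v uv)

      move : ∀ {x u v} → x ∉ U → u ∈ U ∪ ⁅ x ⁆ → v ∉ U ∪ ⁅ x ⁆ → Adj G u v →
             ∃[ C′ ] 𝒞 C′ × Defence G (U ∪ ⁅ x ⁆) C′ u v
      -- The occupied end `u` cannot be the place of the roaming guard: `U` alone covers the edge
      -- and misses `v`.
      move {x} {u} {v} x∉U u∈C v∉C uv with cover u v uv
      ... | inj₂ v∈U = contradiction (∈-add⁺ (inj₁ v∈U)) v∉C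
      ... | inj₁ u∈U with connected u∈U x∉U
      ... | l , w , l! , l⊆ = U ∪ ⁅ v ⁆ , (v , v∉C ∘ ∈-add⁺ ∘ inj₁ , refl) ,
        defence-slide u∈U x∉U (v∉C ∘ ∈-add⁺ ∘ inj₁) (v∉C ∘ ∈-add⁺ ∘ inj₂) uv w l! l⊆

      defends : ∀ {C} → 𝒞 C → ∀ u v → Adj G u v → ∃[ C′ ] 𝒞 C′ × Defence G C C′ u v
      defends {C} C∈@(x , x∉U , refl) u v uv with u ∈? C | v ∈? C
      ... | yes u∈C | yes v∈C = C , C∈ , defence-swap u∈C v∈C uv
      ... | yes u∈C | no  v∉C = move x∉U u∈C v∉C uv
      ... | no  u∉C | yes v∈C with move x∉U v∈C u∉C (Graph.sym G uv)
      ...   | C′ , C′∈ , D = C′ , C′∈ , defence-flip D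
      defends C∈ u v uv | no u∉C | no v∉C = 
        [ (λ u∈C → contradiction u∈C u∉C) , (λ v∈C → contradiction v∈C v∉C) ]′ (covers C∈ u v uv)

  full-class : EvcClass G n (_≡ ⊤)
  full-class = record
    { nonempty = ⊤ , refl
    ; covers   = λ { refl _ _ _ → inj₁ ∈⊤ }
    ; size     = λ { refl → Sub.∣⊤∣≡n n }
    ; defends  = λ { refl _ _ uv → ⊤ , refl , defence-swap ∈⊤ ∈⊤ uv }
    }

-- Halin graphs: upper bound

⟪_⟫ : ∀ {n} {P : Pred (Fin n) 0ℓ} → (∀ x → Dec (P x)) → Subset n
⟪ P? ⟫ = tabulate (does ∘ P?)

module _ {n} {P : Pred (Fin n) 0ℓ} (P? : ∀ x → Dec (P x)) where

  ∈-⟪⟫⁺ : ∀ {x} → P x → x ∈ ⟪ P? ⟫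
  ∈-⟪⟫⁺ {x} Px = Vec.lookup⇒[]= x ⟪ P? ⟫
    (trans (Vec.lookup∘tabulate (does ∘ P?) x) (Dec.dec-true (P? x) Px))

  ∈-⟪⟫⁻ : ∀ {x} → x ∈ ⟪ P? ⟫ → P x
  ∈-⟪⟫⁻ {x} x∈ with P? x | trans (sym (Vec.lookup∘tabulate (does ∘ P?) x)) (Vec.[]=⇒lookup x∈)
  ... | yes Px | _ = Px

length-cartesianProductWith : ∀ {A B C : Set} (f : A → B → C) xs ys →
  length (cartesianProductWith f xs ys) ≡ length xs * length ys
length-cartesianProductWith f []       ys = refl
length-cartesianProductWith f (x ∷ xs) ys = trans (List.length-++ (map (f x) ys))
  (cong₂ _+_ (List.length-map (f x) ys) (length-cartesianProductWith f xs ys))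

firstLeaf-leaf : ∀ {n} {T : Graph n} {E : PlaneEmbedding T} {u v w} → FirstLeaf T E u v w → Leaf T w
firstLeaf-leaf (here leaf) = leaf
firstLeaf-leaf (there _ f) = firstLeaf-leaf f

module HalinCover {n : ℕ} {G : Graph n} (halin : IsHalin G) where
  open IsHalin halin
  open PlaneEmbedding embedding

  T⇒G : ∀ {u v} → Adj T u v → Adj G u v
  T⇒G {u} {v} = Equivalence.from (edges u v) ∘ inj₁

  abstract

    distinct-leaves : ∃[ a ] ∃[ b ] ∃[ c ] (a ≢ b × a ≢ c × b ≢ c) × Leaf T a × Leaf T b × Leaf T c
    distinct-leaves = three-distinct (leaves T) threeLeaves (Unique.filter⁺ (leaf? T) (Unique.allFin⁺ n))
      (proj₂ ∘ L.∈-filter⁻ (leaf? T) {xs = allFin n})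

    leaf-avoiding : ∀ u v → ∃[ w ] w ≢ u × w ≢ v × Leaf T w
    leaf-avoiding u v with distinct-leaves
    ... | a , b , c , (a≢b , a≢c , b≢c) , la , lb , lc
      with a Fin.≟ u | a Fin.≟ v | b Fin.≟ u | b Fin.≟ v
    ... | no a≢u | no a≢v | _ | _ = a , a≢u , a≢v , la
    ... | _ | _ | no b≢u | no b≢v = b , b≢u , b≢v , lb
    ... | yes refl | _ | yes b≡u | _ = contradiction (sym b≡u) a≢b
    ... | _ | yes refl | _ | yes b≡v = contradiction (sym b≡v) a≢b
    ... | yes refl | _ | _ | yes refl = c , a≢c ∘ sym , b≢c ∘ sym , lc
    ... | _ | yes refl | yes refl | _ = c , b≢c ∘ sym , a≢c ∘ sym , lc

    has-neighbour : ∀ v → ∃ (Adj T v)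
    has-neighbour v with leaf-avoiding v v
    ... | w , w≢v , _ with proj₁ tree v w
    ... | ε      = contradiction refl w≢v
    ... | vx ◅ _ = _ , vx

    -- Two adjacent leaves form a whole component of the tree, which a walk to a third leaf would
    -- have to leave.
    leaves-not-adjacent : ∀ {u v} → Leaf T u → Leaf T v → ¬ Adj T u v
    leaves-not-adjacent {u} {v} lu lv uv with leaf-avoiding u v
    ... | w , w≢u , w≢v , _ = trapped (inj₁ refl) (proj₁ tree u w)
      where
      trapped : ∀ {x} → x ≡ u ⊎ x ≡ v → Star (Adj T) x w → ⊥
      trapped (inj₁ x≡u) ε = w≢u x≡u
      trapped (inj₂ x≡v) ε = w≢v x≡v
      trapped (inj₁ refl) (uy ◅ ys) = trapped (inj₂ (leaf-neighbour-unique T lu uy uv)) ys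
      trapped (inj₂ refl) (vy ◅ ys) =
        trapped (inj₁ (leaf-neighbour-unique T lv vy (Graph.sym T uv))) ys

    internal-degree : ∀ {v} → ¬ Leaf T v → 3 ≤ degree T v
    internal-degree {v} ¬leaf with has-neighbour v
    ... | u , vu with degree T v | L.∈-length (∈-neighbours⁺ T vu) | ¬leaf | noDegree2 v
    ... | 1                 | _ | d≢1 | _   = contradiction refl d≢1
    ... | 2                 | _ | _   | d≢2 = contradiction refl d≢2
    ... | suc (suc (suc d)) | _ | _   | _   = s≤s (s≤s (s≤s z≤n))

    exploration : ∃[ W ] Explored T (proj₂ tree) W × (∀ u → u L.∈ W)
    exploration = explored-all T (proj₂ tree) (proj₁ tree) (proj₁ distinct-leaves)

  all-explored = proj₂ (proj₂ exploration)
  open Explored (proj₁ (proj₂ exploration))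

  abstract

    -- Of three neighbours at most one is `parent v`; the edges to the others must be oriented the
    -- other way.
    two-children : ∀ {v} → ¬ Leaf T v → ∃[ a ] ∃[ b ]
      a ≢ b × Adj T v a × Adj T v b × parent a ≡ v × parent b ≡ v
    two-children {v} ¬leaf with three-neighbours T (internal-degree ¬leaf)
    ... | a , b , c , (a≢b , a≢c , b≢c) , va , vb , vc
      with oriented (all-explored v) (all-explored a) va
         | oriented (all-explored v) (all-explored b) vb
         | oriented (all-explored v) (all-explored c) vc
    ... | inj₂ pa   | inj₂ pb   | _         = a , b , a≢b , va , vb , pa , pb
    ... | inj₂ pa   | _         | inj₂ pc   = a , c , a≢c , va , vc , pa , pc
    ... | _         | inj₂ pb   | inj₂ pc   = b , c , b≢c , vb , vc , pb , pc
    ... | inj₁ refl | inj₁ refl | _         = contradiction refl a≢b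
    ... | inj₁ refl | _         | inj₁ refl = contradiction refl a≢c
    ... | _         | inj₁ refl | inj₁ refl = contradiction refl b≢c

  module _ {S : Subset n} (cover : VertexCover G S) where

    U? : ∀ v → Dec (v ∈ S ⊎ ¬ Leaf T v)
    U? v = (v ∈? S) ⊎-dec ¬? (leaf? T v)

    U : Subset n
    U = ⟪ U? ⟫

    Uncovered : Pred (Fin n) 0ℓ
    Uncovered v = ¬ Leaf T v × v ∉ S

    uncovered? : ∀ v → Dec (Uncovered v)
    uncovered? v = ¬? (leaf? T v) ×-dec ¬? (v ∈? S)

    uncovered = filter uncovered? (allFin n)

    Children : List (Fin n) → Set
    Children xs = ∃[ ys ]
      length ys ≡ 2 * length xs × Unique ys × (∀ {y} → y L.∈ ys → y ∈ S × parent y L.∈ xs)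

    -- All neighbours of an uncovered vertex are in S, and distinct uncovered
    -- vertices have distinct children.
    add-children : ∀ {x xs} → All (x ≢_) xs → Uncovered x → Children xs → Children (x ∷ xs)
    add-children {x} {xs} x≢ (¬leaf , x∉S) (ys , eq , ys! , props) with two-children ¬leaf
    ... | a , b , a≢b , xa , xb , pa , pb =
      a ∷ b ∷ ys
      , trans (cong (_+_ 2) eq) (sym (ℕ.*-suc 2 (length xs)))
      , (a≢b ∷ fresh (new pa)) ∷ fresh (new pb) ∷ ys!
      , props′
      where
      new : ∀ {c} → parent c ≡ x → ¬ c L.∈ ys
      new refl c∈ys = All.lookup x≢ (proj₂ (props c∈ys)) refl
      in-S : ∀ {c} → Adj T x c → c ∈ S
      in-S xc with cover _ _ (T⇒G xc)
      ... | inj₁ x∈S = contradiction x∈S x∉S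
      ... | inj₂ c∈S = c∈S
      props′ : ∀ {y} → y L.∈ a ∷ b ∷ ys → y ∈ S × parent y L.∈ x ∷ xs
      props′ (here refl)          = in-S xa , here pa
      props′ (there (here refl))  = in-S xb , here pb
      props′ (there (there y∈ys)) = proj₁ (props y∈ys) , there (proj₂ (props y∈ys))

    uncovered-children : ∀ {xs} → Unique xs → All Uncovered xs → Children xs
    uncovered-children []          []         = [] , refl , [] , λ ()
    uncovered-children (x≢ ∷ xs!) (u ∷ unc) = add-children x≢ u (uncovered-children xs! unc)

    2*uncovered≤∣S∣ : 2 * length uncovered ≤ ∣ S ∣
    2*uncovered≤∣S∣ =
      let (ys , eq , ys! , props) = uncovered-children (Unique.filter⁺ uncovered? (Unique.allFin⁺ n))
                                                       (All.all-filter uncovered? (allFin n))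
      in subst (_≤ ∣ S ∣) eq (unique⇒length≤∣∣ ys! (proj₁ ∘ props))

    ∣U∣≤ : ∣ U ∣ ≤ ∣ S ∣ + length uncovered
    ∣U∣≤ = begin
      ∣ U ∣                               ≤⟨ ⊆⇒∣∣≤length (members S ++ uncovered) U⊆ ⟩
      length (members S ++ uncovered)     ≡⟨ List.length-++ (members S) ⟩
      length (members S) + length uncovered ≡⟨ cong (_+ length uncovered) (length-members S) ⟩
      ∣ S ∣ + length uncovered            ∎
      where
      open ℕ.≤-Reasoning
      U⊆ : ∀ {x} → x ∈ U → x L.∈ members S ++ uncovered
      U⊆ {x} x∈U with x ∈? S | ∈-⟪⟫⁻ U? x∈U
      ... | yes x∈S | _          = L.∈-++⁺ˡ (∈-members⁺ x∈S)
      ... | no  x∉S | inj₁ x∈S   = contradiction x∈S x∉S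
      ... | no  x∉S | inj₂ ¬leaf =
        L.∈-++⁺ʳ (members S) (L.∈-filter⁺ uncovered? (L.∈-allFin x) (¬leaf , x∉S))

    2∣U∣≤3∣S∣ : 2 * ∣ U ∣ ≤ 3 * ∣ S ∣
    2∣U∣≤3∣S∣ = begin
      2 * ∣ U ∣                         ≤⟨ ℕ.*-monoʳ-≤ 2 ∣U∣≤ ⟩
      2 * (∣ S ∣ + length uncovered)    ≡⟨ ℕ.*-distribˡ-+ 2 ∣ S ∣ _ ⟩
      2 * ∣ S ∣ + 2 * length uncovered  ≤⟨ ℕ.+-monoʳ-≤ (2 * ∣ S ∣) 2*uncovered≤∣S∣ ⟩
      2 * ∣ S ∣ + ∣ S ∣                 ≡⟨ ℕ.+-comm (2 * ∣ S ∣) ∣ S ∣ ⟩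
      3 * ∣ S ∣                         ∎
      where open ℕ.≤-Reasoning

    ∉U⇒leaf : ∀ {x} → x ∉ U → Leaf T x
    ∉U⇒leaf {x} x∉U with leaf? T x
    ... | yes leaf = leaf
    ... | no ¬leaf = contradiction (∈-⟪⟫⁺ U? (inj₂ ¬leaf)) x∉U

    U-connected : ∀ {u x} → u ∈ U → x ∉ U → ∃[ l ]
      Walk (Adj G) u x l × Unique l × (∀ {y} → y L.∈ l → y ∈ U ⊎ y ≡ x)
    U-connected {u} {x} u∈U x∉U with path (all-explored u) (all-explored x)
    ... | l , w , l! , _ = l , walk-map T⇒G w , l! , inside-U w l!
      where
      inside-U : ∀ {l} → Walk (Adj T) u x l → Unique l → ∀ {y} → y L.∈ l → y ∈ U ⊎ y ≡ x
      inside-U [-]      _  (here refl) = inj₂ refl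
      inside-U (_ ∷ _)  _  (here refl) = inj₁ u∈U
      inside-U (ua ∷ w) l! (there y∈)  with interior-not-leaf T ua w l! y∈
      ... | inj₁ y≡x   = inj₂ y≡x
      ... | inj₂ ¬leaf = inj₁ (∈-⟪⟫⁺ U? (inj₂ ¬leaf))

    U-cover : VertexCover G U
    U-cover u v uv = Sum.map (∈-⟪⟫⁺ U? ∘ inj₁) (∈-⟪⟫⁺ U? ∘ inj₁) (cover u v uv)

    -- Two consecutive leaves are never both outside S, so rotating any vertex
    -- outside U back around its parent ends in U.
    ∉U⇒next : ∀ {u} → u ∉ U → ∃[ p ] ∃[ w ] p ∈ U × w ∈ U × next p w ≡ u
    ∉U⇒next {u} u∉U with has-neighbour u
    ... | p , up with leaf? T p
    ...   | yes lp    = contradiction up (leaves-not-adjacent (∉U⇒leaf u∉U) lp)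
    ...   | no ¬leafp with other
      where
      other : ∃[ w ] w ≢ u × Adj T p w
      other with two-children ¬leafp
      ... | a , b , a≢b , pa , pb , _ with a Fin.≟ u
      ...   | no a≢u   = a , a≢u , pa
      ...   | yes refl = b , a≢b ∘ sym , pb
    ...     | w₀ , w₀≢u , pw₀ with cyclic pw₀ (Graph.sym T up)
    -- Starting at `w₀ ≢ u` makes the number of turns positive, so there is a last vertex before
    -- `u`.
    ...       | zero  , w₀≡u = contradiction w₀≡u w₀≢u
    ...       | suc k , eq   = p , w , ∈-⟪⟫⁺ U? (inj₂ ¬leafp) , w∈U , eq
      where
      w = fold w₀ (next p) k
      iterate : ∀ k → Adj T p (fold w₀ (next p) k)
      iterate zero    = pw₀
      iterate (suc k) = closed (iterate k)
      w∈U : w ∈ U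
      w∈U with w ∈? U
      ... | yes w∈U = w∈U
      -- From the leaf `w` the boundary passes `p`, turns to `u` and stops, so `wu` is an edge of
      -- the leaf cycle.
      ... | no  w∉U with cover w u (Equivalence.from (edges w u) (inj₂ (inj₁
              ( ∉U⇒leaf w∉U , p , Graph.sym T (iterate k)
              , there ¬leafp (subst (λ x → FirstLeaf T embedding p x u) (sym eq) (here (∉U⇒leaf u∉U)))))))
      ...   | inj₁ w∈S = ∈-⟪⟫⁺ U? (inj₁ w∈S)
      ...   | inj₂ u∈S = contradiction (∈-⟪⟫⁺ U? (inj₁ u∈S)) u∉U

    -- The pair of `p` and `w` from `∉U⇒next` determines the vertex outside `U`, so there are at
    -- most `∣ U ∣ * ∣ U ∣` of these. A bound by the cover alone is what limits the Halin graphs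
    -- with a given mvc.
    order≤ : n ≤ ∣ U ∣ + ∣ U ∣ * ∣ U ∣
    order≤ = begin
      n                              ≡⟨ sym (List.length-tabulate {n = n} id) ⟩
      length (allFin n)              ≤⟨ unique⊆⇒length≤ (Unique.allFin⁺ n) (λ {x} _ → x∈ x) ⟩
      length (Us ++ Us²)             ≡⟨ List.length-++ Us ⟩
      length Us + length Us²         ≡⟨ cong (_+_ (length Us)) (length-cartesianProductWith next Us Us) ⟩
      length Us + length Us * length Us ≡⟨ cong (λ k → k + k * k) (length-members U) ⟩
      ∣ U ∣ + ∣ U ∣ * ∣ U ∣          ∎
      where
      open ℕ.≤-Reasoning
      Us = members U
      Us² = cartesianProductWith next Us Us
      x∈ : ∀ x → x L.∈ Us ++ Us²
      x∈ x with x ∈? U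
      ... | yes x∈U = L.∈-++⁺ˡ (∈-members⁺ x∈U)
      ... | no  x∉U with ∉U⇒next x∉U
      ... | p , w , p∈U , w∈U , refl =
        L.∈-++⁺ʳ Us (L.∈-cartesianProductWith⁺ next (∈-members⁺ p∈U) (∈-members⁺ w∈U))

    evc≤ : ∀ {k} → IsEvc G k → k ≤ suc ∣ U ∣
    evc≤ (_ , min) with Sub.nonempty? (∁ U)
    ... | yes (x , x∈∁) =
      min _ (_ , roaming-class G U-cover U-connected (Sub.x∈∁p⇒x∉p x∈∁))
    -- If `U` contains every vertex, there is no place for a roaming guard; the full configuration
    -- then does with `n ≤ ∣ U ∣` guards.
    ... | no empty = ℕ.≤-trans (min _ (_ , full-class G)) (ℕ.m≤n⇒m≤1+n
      (ℕ.≤-trans (ℕ.≤-reflexive (sym (Sub.∣⊤∣≡n n)))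
        (Sub.p⊆q⇒∣p∣≤∣q∣ {p = ⊤} λ {x} _ → Dec.decidable-stable (x ∈? U)
          (λ x∉U → empty (x , Sub.x∉p⇒x∈∁p x∉U)))))

  evc≤3/2mvc+1 : ∀ {k m} → IsEvc G k → IsMvc G m → 2 * k ≤ 3 * m + 2
  evc≤3/2mvc+1 {k} evc ((S , cover , refl) , _) = begin
    2 * k                  ≤⟨ ℕ.*-monoʳ-≤ 2 (evc≤ cover evc) ⟩
    2 * suc ∣ U cover ∣    ≡⟨ ℕ.*-suc 2 ∣ U cover ∣ ⟩
    2 + 2 * ∣ U cover ∣    ≡⟨ ℕ.+-comm 2 _ ⟩
    2 * ∣ U cover ∣ + 2    ≤⟨ ℕ.+-monoˡ-≤ 2 (2∣U∣≤3∣S∣ cover) ⟩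
    3 * ∣ S ∣ + 2          ∎
    where open ℕ.≤-Reasoning

  order≤2mvc+4mvc² : ∀ {m} → IsMvc G m → n ≤ 2 * m + 2 * m * (2 * m)
  order≤2mvc+4mvc² ((S , cover , refl) , _) =
    ℕ.≤-trans (order≤ cover) (ℕ.+-mono-≤ ∣U∣≤2∣S∣ (ℕ.*-mono-≤ ∣U∣≤2∣S∣ ∣U∣≤2∣S∣))
    where
    ∣U∣≤2∣S∣ : ∣ U cover ∣ ≤ 2 * ∣ S ∣
    ∣U∣≤2∣S∣ = ℕ.≤-trans (∣U∣≤ cover) (ℕ.+-monoʳ-≤ ∣ S ∣ (ℕ.≤-trans
      (ℕ.m≤m+n _ _) (ℕ.≤-trans (2*uncovered≤∣S∣ cover) (ℕ.≤-reflexive (sym (ℕ.+-identityʳ _))))))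

-- Enumerating graphs up to isomorphism

entry : ∀ {n} → Vec (Vec Bool n) n → Fin n → Fin n → Bool
entry M u v = lookup (lookup M u) v

-- Demanding both entries and distinct ends makes the relation symmetric and irreflexive for every
-- Boolean matrix, so the enumeration needs no filter.
fromMatrix : ∀ {n} → Vec (Vec Bool n) n → Graph n
fromMatrix M = record
  { Adj    = λ u v → u ≢ v × entry M u v ≡ true × entry M v u ≡ true
  ; adj?   = λ u v → ¬? (u Fin.≟ v) ×-dec (entry M u v Bool.≟ true) ×-dec (entry M v u Bool.≟ true)
  ; sym    = λ (u≢v , uv , vu) → u≢v ∘ sym , vu , uv
  ; irrefl = λ u≡v (u≢v , _) → u≢v u≡v
  }

module _ {n : ℕ} (G : Graph n) where

  toMatrix : Vec (Vec Bool n) n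
  toMatrix = tabulate λ u → tabulate λ v → does (adj? G u v)

  entry-toMatrix : ∀ u v → entry toMatrix u v ≡ does (adj? G u v)
  entry-toMatrix u v = trans (cong (λ row → lookup row v) (Vec.lookup∘tabulate _ u)) (Vec.lookup∘tabulate _ v)

  entry⁺ : ∀ {u v} → Adj G u v → entry toMatrix u v ≡ true
  entry⁺ {u} {v} uv = trans (entry-toMatrix u v) (Dec.dec-true (adj? G u v) uv)

  entry⁻ : ∀ {u v} → entry toMatrix u v ≡ true → Adj G u v
  entry⁻ {u} {v} eq with adj? G u v | trans (sym (entry-toMatrix u v)) eq
  ... | yes uv | _ = uv

  -- The relation `Adj G` is equivalent to the one read off its matrix but need not equal it, so the
  -- two graphs are compared by the identity isomorphism.
  ≅-fromMatrix : (n , G) ≅ (n , fromMatrix toMatrix)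
  ≅-fromMatrix = Perm.id , λ u v → mk⇔
    (λ uv → (λ u≡v → Graph.irrefl G u≡v uv) , entry⁺ uv , entry⁺ (Graph.sym G uv))
    (λ (_ , eq , _) → entry⁻ eq)

graphsOfOrder : ℕ → List FinGraph
graphsOfOrder n = map (λ M → n , fromMatrix M) (vecs (subsets n) n)

graphsUpTo : ℕ → List FinGraph
graphsUpTo N = concatMap graphsOfOrder (upTo (suc N))

∈-graphsUpTo : ∀ {N n} (G : Graph n) → n ≤ N → (n , fromMatrix (toMatrix G)) L.∈ graphsUpTo N
∈-graphsUpTo {n = n} G n≤N = L.∈-concat⁺′
  (L.∈-map⁺ (λ M → n , fromMatrix M) (∈-vecs ∈-subsets (toMatrix G)))
  (L.∈-map⁺ graphsOfOrder (L.∈-upTo⁺ (s≤s n≤N)))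

-- Ratios

-- `+ k / m` is reduced to lowest terms, so `k` and `m` need not be its numerator and denominator;
-- passing to unnormalised rationals brings them back.
<⇒cross : ∀ (q : ℚ) k m .{{_ : NonZero m}} → q ℚ.< + k / m → ℚ.↥ q ℤ.* + m ℤ.< + k ℤ.* ℚ.↧ q
<⇒cross q@record{} k m@(suc m-1) q<k/m =
  ℚᵘ.drop-*<* (ℚᵘ.<-≤-trans (ℚ.toℚᵘ-mono-< q<k/m)
    (ℚᵘ.≤-reflexive (ℚ.toℚᵘ-fromℚᵘ (ℚᵘ.mkℚᵘ (+ k) m-1))))

cross⇒7/6≤ : ∀ k m .{{_ : NonZero m}} → 7 * m ≤ 6 * k → + 7 / 6 ℚ.≤ + k / m
cross⇒7/6≤ k m@(suc m-1) 7m≤6k = ℚ.toℚᵘ-cancel-≤ (ℚᵘ.≤-trans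
  (ℚᵘ.*≤* (subst₂ ℤ._≤_ (ℤ.pos-* 7 m) (trans (cong +_ (ℕ.*-comm 6 k)) (ℤ.pos-* k 6)) (ℤ.+≤+ 7m≤6k)))
  (ℚᵘ.≤-reflexive (ℚᵘ.≃-sym (ℚ.toℚᵘ-fromℚᵘ (ℚᵘ.mkℚᵘ (+ k) m-1)))))

-- With `a = a′ / b`, integrality sharpens `3b < 2a′` to `3b + 1 ≤ 2a′`. After multiplication by `m`
-- the extra unit becomes `m`, while the additive 2 contributes `2b` on the other side, and the
-- common `3bm` cancels.
cross-bound : ∀ {a b k m} → + 3 / 2 ℚ.< a → b ≡ ℚ.↧ₙ a →
              ℚ.↥ a ℤ.* + m ℤ.< + k ℤ.* + b → 2 * k ≤ 3 * m + 2 → m < 2 * b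
cross-bound {a} {b} {k} {m} (ℚ.*<* 3b<2a) refl am<kb 2k≤3m+2 with ℚ.↥ a
... | ℤ.-[1+ a′ ] = case subst (λ z → z ℤ.< ℤ.-[1+ a′ ] ℤ.* + 2) (sym (ℤ.pos-* 3 b)) 3b<2a of λ ()
... | + a′ = ℕ.+-cancelˡ-< (3 * b * m) m (2 * b) (begin-strict
  3 * b * m + m        ≡⟨ ℕ.+-comm (3 * b * m) m ⟩
  suc (3 * b) * m      ≤⟨ ℕ.*-monoˡ-≤ m 3b<2a′ ⟩
  a′ * 2 * m           ≡⟨ cong (_* m) (ℕ.*-comm a′ 2) ⟩
  2 * a′ * m           ≡⟨ ℕ.*-assoc 2 a′ m ⟩
  2 * (a′ * m)         <⟨ ℕ.*-monoʳ-< 2 am<kb′ ⟩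
  2 * (k * b)          ≡⟨ sym (ℕ.*-assoc 2 k b) ⟩
  2 * k * b            ≤⟨ ℕ.*-monoˡ-≤ b 2k≤3m+2 ⟩
  (3 * m + 2) * b      ≡⟨ ℕ.*-distribʳ-+ b (3 * m) 2 ⟩
  3 * m * b + 2 * b    ≡⟨ cong (_+ 2 * b) (trans (ℕ.*-assoc 3 m b)
                            (trans (cong (3 *_) (ℕ.*-comm m b)) (sym (ℕ.*-assoc 3 b m)))) ⟩
  3 * b * m + 2 * b    ∎)
  where
  open ℕ.≤-Reasoning
  3b<2a′ : 3 * b < a′ * 2
  3b<2a′ = ℤ.drop‿+<+ (subst₂ ℤ._<_ (sym (ℤ.pos-* 3 b)) (sym (ℤ.pos-* a′ 2)) 3b<2a)
  am<kb′ : a′ * m < k * b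
  am<kb′ = ℤ.drop‿+<+ (subst₂ ℤ._<_ (sym (ℤ.pos-* a′ m)) (sym (ℤ.pos-* k b)) am<kb)

ρ-Halin≤3/2 : ρ Halin ≤ₑ rational (+ 3 / 2)
ρ-Halin≤3/2 {q} (r , infinite , q∈r) with q ℚ.<? + 3 / 2
... | yes q<3/2 = q<3/2
... | no  q≮3/2 = case infinite (graphsUpTo N) of λ where
    ((n , G) , (halin , k , m , evc , mvc , m≢0 , r≤k/m) , new) →
      let m<2b = cross-bound {q′} {k = k} {m} 3/2<q′ refl (<⇒cross q′ k m {{m≢0}} (r≤k/m q′∈r))
                   (HalinCover.evc≤3/2mvc+1 halin evc mvc)
          2m≤2M = ℕ.*-monoʳ-≤ 2 (ℕ.<⇒≤ m<2b)
          n≤N = ℕ.≤-trans (HalinCover.order≤2mvc+4mvc² halin mvc) (ℕ.+-mono-≤ 2m≤2M (ℕ.*-mono-≤ 2m≤2M 2m≤2M))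
      in ⊥-elim (All.lookup new (∈-graphsUpTo G n≤N) (≅-fromMatrix G))
  where
  -- `q` may equal 3/2, where the additive 2 would leave `m` unbounded. Openness of the cut gives
  -- `q′` strictly above 3/2.
  q′ = proj₁ (ℝ.open-up r q∈r)
  q′∈r = proj₂ (proj₂ (ℝ.open-up r q∈r))
  3/2<q′ : + 3 / 2 ℚ.< q′
  3/2<q′ = ℚ.≤-<-trans (ℚ.≮⇒≥ q≮3/2) (proj₁ (proj₂ (ℝ.open-up r q∈r)))
  -- `M` bounds mvc by `cross-bound`, and `N` is the bound on the order that results.
  M = 2 * ℚ.↧ₙ q′
  N = 2 * M + 2 * M * (2 * M)

-- Existence of mvc and evc

module _ {n : ℕ} (G : Graph n) where

  vertexCover? : ∀ S → Dec (VertexCover G S)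
  vertexCover? S = Fin.all? λ u → Fin.all? λ v → adj? G u v →-dec ((u ∈? S) ⊎-dec (v ∈? S))

  mvc-exists : ∃ (IsMvc G)
  mvc-exists = least (λ k → any∈? (λ S → vertexCover? S ×-dec (∣ S ∣ ℕ.≟ k)) ∈-subsets)
                     (⊤ , (λ _ _ _ → inj₁ ∈⊤) , refl)

  module _ (C C′ : Subset n) (u v : Fin n) where

    DefendedBy : (Fin n → Fin n) → Set
    DefendedBy φ =
      (∀ w → w ∈ C → φ w ∈ C′) ×
      (∀ w → w ∈ C → ∀ x → x ∈ C → φ w ≡ φ x → w ≡ x) ×
      (∀ y → y ∈ C′ → ∃[ w ] w ∈ C × φ w ≡ y) ×
      (∀ w → w ∈ C → φ w ≡ w ⊎ Adj G w (φ w)) ×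
      ((u ∈ C × φ u ≡ v) ⊎ (v ∈ C × φ v ≡ u))

    defendedBy? : ∀ φ → Dec (DefendedBy φ)
    defendedBy? φ =
      Fin.all? (λ w → (w ∈? C) →-dec (φ w ∈? C′)) ×-dec
      Fin.all? (λ w → (w ∈? C) →-dec Fin.all? λ x → (x ∈? C) →-dec ((φ w Fin.≟ φ x) →-dec (w Fin.≟ x))) ×-dec
      Fin.all? (λ y → (y ∈? C′) →-dec Fin.any? λ w → (w ∈? C) ×-dec (φ w Fin.≟ y)) ×-dec
      Fin.all? (λ w → (w ∈? C) →-dec ((φ w Fin.≟ w) ⊎-dec adj? G w (φ w))) ×-dec
      (((u ∈? C) ×-dec (φ u Fin.≟ v)) ⊎-dec ((v ∈? C) ×-dec (φ v Fin.≟ u)))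

    -- The search runs over tables of values, and a map agrees with `lookup` in its table only
    -- pointwise.
    defendedBy-resp : ∀ {φ ψ} → (∀ w → φ w ≡ ψ w) → DefendedBy φ → DefendedBy ψ
    defendedBy-resp eq (into , inj , surj , moves , repels) =
      (λ w w∈C → subst (_∈ C′) (eq w) (into w w∈C)) ,
      (λ w w∈C x x∈C ψw≡ψx → inj w w∈C x x∈C (trans (eq w) (trans ψw≡ψx (sym (eq x))))) ,
      (λ y y∈C′ → let (w , w∈C , φw≡y) = surj y y∈C′ in w , w∈C , trans (sym (eq w)) φw≡y) ,
      (λ w w∈C → subst (λ x → x ≡ w ⊎ Adj G w x) (eq w) (moves w w∈C)) ,
      Sum.map (λ (u∈C , φu≡v) → u∈C , trans (sym (eq u)) φu≡v)
              (λ (v∈C , φv≡u) → v∈C , trans (sym (eq v)) φv≡u) repels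

    defence⇒ : (D : Defence G C C′ u v) → DefendedBy (Defence.φ D)
    defence⇒ D =
      (λ _ → into) , (λ _ w∈C _ x∈C → injective w∈C x∈C) , (λ _ → surjective) , (λ _ → moves) , repels
      where open Defence D

    ⇒defence : ∀ {φ} → DefendedBy φ → Defence G C C′ u v
    ⇒defence {φ} (into , inj , surj , moves , repels) = record
      { φ = φ ; into = into _ ; injective = λ w∈C x∈C → inj _ w∈C _ x∈C ; surjective = surj _
      ; moves = moves _ ; repels = repels }

    defence? : Dec (Defence G C C′ u v)
    defence? = Dec.map′ (λ (_ , d) → ⇒defence d)
      (λ D → tabulate (Defence.φ D) ,
        defendedBy-resp (λ w → sym (Vec.lookup∘tabulate (Defence.φ D) w)) (defence⇒ D))
      (any∈? (defendedBy? ∘ lookup) (∈-vecs L.∈-allFin))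

  DefendedIn : List (Subset n) → Subset n → Set
  DefendedIn Cs C = ∀ u v → Adj G u v → Any (λ C′ → Defence G C C′ u v) Cs

  defendedIn? : ∀ Cs C → Dec (DefendedIn Cs C)
  defendedIn? Cs C = Fin.all? λ u → Fin.all? λ v →
    adj? G u v →-dec Any.any? (λ C′ → defence? C C′ u v) Cs

  module _ (k : ℕ) where

    Guarding : Pred (Subset n) 0ℓ
    Guarding C = VertexCover G C × ∣ C ∣ ≡ k

    guarding? : ∀ C → Dec (Guarding C)
    guarding? C = vertexCover? C ×-dec (∣ C ∣ ℕ.≟ k)

    -- Confinement to a list makes an arbitrary predicate accessible to search; for the list of all
    -- `Guarding` subsets it is no restriction.
    Class : List (Subset n) → Set₁
    Class Cs = ∃[ 𝒞 ] EvcClass G k 𝒞 × (∀ {C} → 𝒞 C → C L.∈ Cs)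

    -- The answers of a class are again members of it, hence in `Cs`; so discarding the undefended
    -- configurations of `Cs` loses no member of a class.
    class-defended : ∀ {Cs} ((𝒞 , _) : Class Cs) → ∀ {C} → 𝒞 C → DefendedIn Cs C
    class-defended (𝒞 , E , ⊆Cs) C∈𝒞 u v uv with EvcClass.defends E C∈𝒞 u v uv
    ... | _ , C′∈𝒞 , D = L.lose (⊆Cs C′∈𝒞) D

    stable⇒class : ∀ {Cs} → All Guarding Cs → All (DefendedIn Cs) Cs → Dec (Class Cs)
    stable⇒class {[]}     _        _        = no λ (_ , E , ⊆Cs) → case ⊆Cs (proj₂ (EvcClass.nonempty E)) of λ ()
    stable⇒class {C ∷ Cs} guarding defended = yes ((L._∈ C ∷ Cs) , record
      { nonempty = C , here refl
      ; covers   = proj₁ ∘ All.lookup guarding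
      ; size     = proj₂ ∘ All.lookup guarding
      ; defends  = λ C∈ u v uv → L.find (All.lookup defended C∈ u v uv)
      } , id)

    -- Discarding undefended configurations reaches the largest class in Cs.
    class? : ∀ d Cs → length Cs ≤ d → All Guarding Cs → Dec (Class Cs)
    class? d Cs len guarding with All.all? (defendedIn? Cs) Cs
    ... | yes defended = stable⇒class guarding defended
    class? zero    [] len guarding | no ¬defended = contradiction [] ¬defended
    class? (suc d) Cs len guarding | no ¬defended =
      Dec.map′
        (λ (𝒞 , E , ⊆Cs′) → 𝒞 , E , proj₁ ∘ L.∈-filter⁻ (defendedIn? Cs) {xs = Cs} ∘ ⊆Cs′)
        (λ (𝒞 , E , ⊆Cs) → 𝒞 , E , λ {_} C∈𝒞 →
          L.∈-filter⁺ (defendedIn? Cs) (⊆Cs C∈𝒞) (class-defended (𝒞 , E , ⊆Cs) C∈𝒞))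
        (class? d (filter (defendedIn? Cs) Cs)
          (ℕ.≤-pred (ℕ.≤-trans (List.filter-notAll (defendedIn? Cs) Cs (All.¬All⇒Any¬ (defendedIn? Cs) Cs ¬defended)) len))
          (All.filter⁺ (defendedIn? Cs) guarding))

    evcClass? : Dec (∃[ 𝒞 ] EvcClass G k 𝒞)
    evcClass? = Dec.map′
      (λ (𝒞 , E , _) → 𝒞 , E)
      (λ (𝒞 , E) → 𝒞 , E , λ {C} C∈𝒞 →
        L.∈-filter⁺ guarding? (∈-subsets C) (EvcClass.covers E C∈𝒞 , EvcClass.size E C∈𝒞))
      (class? _ Cs ℕ.≤-refl (All.all-filter guarding? (subsets n)))
      where Cs = filter guarding? (subsets n)

  evc-exists : ∃ (IsEvc G)
  evc-exists = least evcClass? (_ , full-class G)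

-- Trees given by a parent relation

module _ {n : ℕ} (T : Graph n) where

  CycleNeighbours : List (Fin n) → Fin n → Set
  CycleNeighbours L x = ∃₂ λ y z → y ≢ z × y L.∈ L × z L.∈ L × Adj T x y × Adj T x z

  last-neighbour : ∀ {e} c l → Linked (Adj T) (c ∷ l ++ e ∷ []) → ∃[ z ] z L.∈ c ∷ l × Adj T z e
  last-neighbour c []      (ce ∷ _)  = c , here refl , ce
  last-neighbour c (d ∷ l) (_ ∷ lnk) with last-neighbour d l lnk
  ... | z , z∈ , ze = z , there z∈ , ze

  -- `p` precedes the list and `e` follows it. At the start of a cycle both are its base vertex, and
  -- the two neighbours differ because the list is long enough; from the next vertex on, `p ≢ e`
  -- takes over.
  inner-neighbours : ∀ {L e} p l → Unique (p ∷ l) → p ≢ e ⊎ 2 ≤ length l → ¬ e L.∈ l → e L.∈ L →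
                     (∀ {y} → y L.∈ p ∷ l → y L.∈ L) → Linked (Adj T) (p ∷ l ++ e ∷ []) →
                     ∀ {x} → x L.∈ l → CycleNeighbours L x
  inner-neighbours p (c ∷ []) _ p≢e _ e∈L l⊆L (pc ∷ ce ∷ _) (here refl) =
    p , _ , [ id , (λ { (s≤s ()) }) ]′ p≢e , l⊆L (here refl) , e∈L , Graph.sym T pc , ce
  inner-neighbours p (c ∷ d ∷ l) ((_ ∷ p≢d ∷ _) ∷ _) _ _ _ l⊆L (pc ∷ cd ∷ _) (here refl) =
    p , d , p≢d , l⊆L (here refl) , l⊆L (there (there (here refl))) , Graph.sym T pc , cd
  inner-neighbours p (c ∷ l) (_ ∷ l!) _ e∉l e∈L l⊆L (_ ∷ lnk) (there x∈l) =
    inner-neighbours c l l! (inj₁ λ { refl → e∉l (here refl) }) (e∉l ∘ there) e∈L (l⊆L ∘ there) lnk x∈l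

  cycle-neighbours : ∀ {v vs} → IsCycle T v vs → ∀ {x} → x L.∈ v ∷ vs → CycleNeighbours (v ∷ vs) x
  cycle-neighbours {v} {a ∷ b ∷ l} (_ , _ ∷ (a≢ ∷ _) , va ∷ _ ∷ lnk) (here refl)
    with last-neighbour b l lnk
  ... | z , z∈ , zv = a , z , All.lookup a≢ z∈ , there (here refl) , there (there z∈) , va , Graph.sym T zv
  cycle-neighbours {v} {vs} (2≤ , vs!@(v≢ ∷ _) , lnk) (there x∈) =
    inner-neighbours v vs vs! (inj₂ 2≤) (λ v∈ → All.lookup v≢ v∈ refl) (here refl) id lnk x∈
  cycle-neighbours {vs = []}     (() , _)
  cycle-neighbours {vs = _ ∷ []} (s≤s () , _)

  module _ {Up : Rel (Fin n) 0ℓ} (oriented : ∀ {u v} → Adj T u v → Up u v ⊎ Up v u)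
           (up⇒adj : ∀ {u v} → Up u v → Adj T u v)
           (functional : ∀ {u v w} → Up u v → Up u w → v ≡ w)
           (rank : Fin n → ℕ) (decreasing : ∀ {u v} → Up u v → rank v < rank u)
           {B : ℕ} (bounded : ∀ v → rank v ≤ B)
           {r : Fin n} (has-up : ∀ v → v ≡ r ⊎ ∃ (Up v)) where

    -- A vertex of a cycle has two neighbours on it, one of which is not its
    -- parent, so ranks on the cycle would be unbounded.
    parent⇒acyclic : ∀ v vs → ¬ IsCycle T v vs
    parent⇒acyclic v vs cyc = case climb (suc B) of λ (x , _ , B<x) → ℕ.<⇒≱ B<x (bounded x)
      where
      climb : ∀ k → ∃[ x ] x L.∈ v ∷ vs × k ≤ rank x
      climb zero    = v , here refl , z≤n
      climb (suc k) with climb k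
      ... | x , x∈ , k≤x with cycle-neighbours cyc x∈
      ... | y , z , y≢z , y∈ , z∈ , xy , xz with oriented xy | oriented xz
      ... | inj₂ yx | _       = y , y∈ , ℕ.≤-<-trans k≤x (decreasing yx)
      ... | _       | inj₂ zx = z , z∈ , ℕ.≤-<-trans k≤x (decreasing zx)
      ... | inj₁ xy | inj₁ xz = contradiction (functional xy xz) y≢z

    to-root : ∀ d v → rank v ≤ d → Star (Adj T) v r
    to-root d v v≤d with has-up v
    ... | inj₁ refl = ε
    to-root zero    v v≤0 | inj₂ (w , vw) = case ℕ.<-≤-trans (decreasing vw) v≤0 of λ ()
    to-root (suc d) v v≤d | inj₂ (w , vw) =
      up⇒adj vw ◅ to-root d w (ℕ.≤-pred (ℕ.<-≤-trans (decreasing vw) v≤d))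

    parent⇒tree : IsTree T
    parent⇒tree =
      (λ u v → to-root B u (bounded u) ◅◅ Star.reverse (Graph.sym T) (to-root B v (bounded v))) ,
      parent⇒acyclic

-- Orbits of a map and the cyclic shift of a finite set

Reaches : ∀ {A : Set} → (A → A) → Rel A 0ℓ
Reaches f u w = ∃[ k ] fold u f k ≡ w

module _ {A : Set} {f : A → A} where

  reaches-refl : ∀ {u} → Reaches f u u
  reaches-refl = 0 , refl

  reaches-step : ∀ {u} → Reaches f u (f u)
  reaches-step = 1 , refl

  fold-+ : ∀ {u} k l → fold (fold u f k) f l ≡ fold u f (l + k)
  fold-+ k zero    = refl
  fold-+ k (suc l) = cong f (fold-+ k l)

  reaches-trans : ∀ {u v w} → Reaches f u v → Reaches f v w → Reaches f u w
  reaches-trans {u} (k , refl) (l , eq) = l + k , trans (sym (fold-+ k l)) eq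

rotate : ∀ {m} → Fin m → Fin m
rotate {suc _} i with Top.view i
... | Top.‵fromℕ     = zero
... | Top.‵inject₁ j = suc j

rotate-fromℕ : ∀ m → rotate (Fin.fromℕ m) ≡ zero
rotate-fromℕ m rewrite Top.view-fromℕ m = refl

rotate-inject₁ : ∀ {m} (j : Fin m) → rotate (Fin.inject₁ j) ≡ suc j
rotate-inject₁ j rewrite Top.view-inject₁ j = refl

-- Climb from `i` to the top, wrap around to zero, and climb to `j`.
rotate-reaches : ∀ {m} (i j : Fin m) → Reaches rotate i j
rotate-reaches {suc m} i j = reaches-trans (to-zero i) (from-zero j)
  where
  from-zero : ∀ j → Reaches rotate zero j
  from-zero = Fin.<-weakInduction _ reaches-refl λ j r →
    reaches-trans r (subst (Reaches rotate _) (rotate-inject₁ j) reaches-step)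
  to-zero : ∀ i → Reaches rotate i zero
  to-zero = Fin.>-weakInduction _ (subst (Reaches rotate _) (rotate-fromℕ m) reaches-step) λ i r →
    reaches-trans (subst (Reaches rotate _) (rotate-inject₁ i) reaches-step) r

-- The gadget family

pattern b₀ = zero
pattern ℓ₁ = suc b₀
pattern p₀ = suc ℓ₁
pattern ℓ₂ = suc p₀
pattern ℓ₃ = suc ℓ₂
pattern ℓ₄ = suc ℓ₃
pattern q₀ = suc ℓ₄
pattern ℓ₅ = suc q₀
pattern ℓ₆ = suc ℓ₅
pattern ℓ₇ = suc ℓ₆

-- A gadget is a tree with root b₀: b₀ has children ℓ₁ and p₀; p₀ has children
-- ℓ₂, ℓ₃, ℓ₄, q₀ and ℓ₇; q₀ has children ℓ₅ and ℓ₆. Vertices are numbered in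
-- preorder.
parent : Fin 9 → Fin 10
parent = lookup (b₀ ∷ b₀ ∷ p₀ ∷ p₀ ∷ p₀ ∷ p₀ ∷ q₀ ∷ q₀ ∷ p₀ ∷ [])

local : Fin 10 → List (Fin 10)
local b₀ = ℓ₁ ∷ p₀ ∷ []
local p₀ = b₀ ∷ ℓ₂ ∷ ℓ₃ ∷ ℓ₄ ∷ q₀ ∷ ℓ₇ ∷ []
local q₀ = p₀ ∷ ℓ₅ ∷ ℓ₆ ∷ []
local (suc j) = parent j ∷ []

-- The cyclic order of the neighbours of p₀ and of q₀.
turn : Fin 10 → Fin 10 → Fin 10
turn p₀ b₀ = ℓ₂
turn p₀ ℓ₂ = ℓ₃
turn p₀ ℓ₃ = ℓ₄
turn p₀ ℓ₄ = q₀
turn p₀ q₀ = ℓ₇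
turn p₀ ℓ₇ = b₀
turn q₀ p₀ = ℓ₅
turn q₀ ℓ₅ = ℓ₆
turn q₀ ℓ₆ = p₀
turn _  j  = j

open import Data.List.Relation.Unary.Unique.DecPropositional (Fin._≟_ {10}) using (unique?)

-- A gadget vertex has at most six neighbours, so exponents below 6 suffice and the condition is
-- decidable. b₀ is left out, since the root is among its neighbours.
Cyclic : Fin 9 → Fin 10 → Fin 10 → Set
Cyclic j u w = Σ (Fin 6) λ k → fold u (turn (suc j)) (toℕ k) ≡ w

cyclic? : ∀ j u w → Dec (Cyclic j u w)
cyclic? j u w = Fin.any? λ k → fold u (turn (suc j)) (toℕ k) Fin.≟ w

abstract

  parent≤ : ∀ j → toℕ (parent j) ≤ toℕ j
  parent≤ = from-yes (Fin.all? λ j → toℕ (parent j) ℕ.≤? toℕ j)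

  parent∈local : ∀ j → parent j L.∈ local (suc j)
  parent∈local = from-yes (Fin.all? λ j → parent j ∈ₗ? local (suc j))

  child∈local : ∀ j → suc j L.∈ local (parent j)
  child∈local = from-yes (Fin.all? λ j → suc j ∈ₗ? local (parent j))

  local-tree : ∀ j → All (λ k → (∃[ j′ ] suc j′ ≡ j × parent j′ ≡ k) ⊎ (∃[ k′ ] suc k′ ≡ k × parent k′ ≡ j)) (local j)
  local-tree = from-yes (Fin.all? λ j → All.all? (λ k →
    Fin.any? (λ j′ → (suc j′ Fin.≟ j) ×-dec (parent j′ Fin.≟ k)) ⊎-dec
    Fin.any? (λ k′ → (suc k′ Fin.≟ k) ×-dec (parent k′ Fin.≟ j))) (local j))

  local-unique : ∀ j → Unique (local j)
  local-unique = from-yes (Fin.all? (unique? ∘ local))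

  turn-local : ∀ j → All (λ k → turn j k L.∈ local j) (local j)
  turn-local = from-yes (Fin.all? λ j → All.all? (λ k → turn j k ∈ₗ? local j) (local j))

  turn-cyclic : ∀ j → All (λ u → All (Cyclic j u) (local (suc j))) (local (suc j))
  turn-cyclic = from-yes (Fin.all? λ j → All.all? (λ u → All.all? (cyclic? j u) (local (suc j))) (local (suc j)))

  local-no-degree-2 : ∀ j → ¬ length (local (suc j)) ≡ 2
  local-no-degree-2 = from-yes (Fin.all? λ j → ¬? (length (local (suc j)) ℕ.≟ 2))

-- The tree with `g` gadgets at a common root

data Vertex (g : ℕ) : Set where
  root : Vertex g
  at   : Fin g → Fin 10 → Vertex g

at-injective : ∀ {g} {i : Fin g} {j j′} → at i j ≡ at i j′ → j ≡ j′
at-injective refl = refl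

∣++∣ : ∀ {m n} (p : Subset m) (q : Subset n) → ∣ p Vec.++ q ∣ ≡ ∣ p ∣ + ∣ q ∣
∣++∣ []          q = refl
∣++∣ (true ∷ p)  q = cong suc (∣++∣ p q)
∣++∣ (false ∷ p) q = ∣++∣ p q

∣concat-replicate∣ : ∀ g {b} (X : Subset b) → ∣ Vec.concat (Vec.replicate g X) ∣ ≡ g * ∣ X ∣
∣concat-replicate∣ zero    X = refl
∣concat-replicate∣ (suc g) X = trans (∣++∣ X _) (cong (_+_ ∣ X ∣) (∣concat-replicate∣ g X))

blocks-≤ : ∀ {b c} g (S : Subset (g * b)) →
           (∀ (i : Fin g) → c ≤ ∣ tabulate {n = b} (λ j → lookup S (combine i j)) ∣) → g * c ≤ ∣ S ∣
blocks-≤ zero    S c≤ = z≤n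
blocks-≤ {b} {c} (suc g) S c≤ with Vec.splitAt b S
... | p , q , refl = begin
  c + g * c      ≤⟨ ℕ.+-mono-≤ (subst (λ p → c ≤ ∣ p ∣) eq₀ (c≤ zero))
                               (blocks-≤ g q λ i → subst (λ p → c ≤ ∣ p ∣) (eq i) (c≤ (suc i))) ⟩
  ∣ p ∣ + ∣ q ∣  ≡⟨ sym (∣++∣ p q) ⟩
  ∣ p Vec.++ q ∣ ∎
  where
  open ℕ.≤-Reasoning
  eq₀ : tabulate (λ j → lookup (p Vec.++ q) (combine {suc g} zero j)) ≡ p
  eq₀ = trans (Vec.tabulate-cong (Vec.lookup-++ˡ p q)) (Vec.tabulate∘lookup p)
  eq : ∀ (i : Fin g) → tabulate (λ j → lookup (p Vec.++ q) (combine (suc i) j)) ≡ tabulate (λ j → lookup q (combine i j))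
  eq i = Vec.tabulate-cong (λ j → Vec.lookup-++ʳ p q (combine i j))

-- The root has `g` neighbours; `3 ≤ g` makes it neither a leaf nor a vertex of degree two.
module Family (g : ℕ) (3≤g : 3 ≤ g) where

  V = Vertex g

  abstract
    n : ℕ
    n = suc (g * 10)

    enc : V → Fin n
    enc root     = zero
    enc (at i j) = suc (combine i j)

    dec : Fin n → V
    dec zero    = root
    dec (suc x) = uncurry at (remQuot 10 x)

    dec-enc : ∀ u → dec (enc u) ≡ u
    dec-enc root     = refl
    dec-enc (at i j) = cong (uncurry at) (Fin.remQuot-combine i j)

    enc-dec : ∀ x → enc (dec x) ≡ x
    enc-dec zero    = refl
    enc-dec (suc x) = cong suc (Fin.combine-remQuot {g} 10 x)

    g<n : g < n
    g<n = s≤s (ℕ.m≤m*n g 10)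

  gadget : Subset n → Fin g → Subset 10
  gadget S i = tabulate λ j → lookup S (enc (at i j))

  abstract
    gadgets-≤ : ∀ {c} (S : Subset n) → (∀ i → c ≤ ∣ gadget S i ∣) → g * c ≤ ∣ S ∣
    gadgets-≤ (x ∷ S) c≤ = ℕ.≤-trans (blocks-≤ {10} g S c≤) (Sub.∣p∣≤∣x∷p∣ x S)

    -- The leading `true` is the root. It covers the edges to the vertices b₀, which the gadget
    -- cover used below omits.
    copies : Subset 10 → Subset n
    copies X = true ∷ Vec.concat (Vec.replicate g X)

    ∣copies∣ : ∀ X → ∣ copies X ∣ ≡ suc (g * ∣ X ∣)
    ∣copies∣ X = cong suc (∣concat-replicate∣ g X)

    lookup-copies-root : ∀ X → lookup (copies X) (enc root) ≡ true
    lookup-copies-root X = refl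

    lookup-copies : ∀ X i j → lookup (copies X) (enc (at i j)) ≡ lookup X j
    lookup-copies X i j = trans (Vec.lookup-concat (Vec.replicate g X) i j)
      (cong (λ Y → lookup Y j) (Vec.lookup-replicate i X))

  enc-injective : ∀ {u v} → enc u ≡ enc v → u ≡ v
  enc-injective {u} {v} eq = trans (sym (dec-enc u)) (trans (cong dec eq) (dec-enc v))

  _≟ᵥ_ : (u v : V) → Dec (u ≡ v)
  u ≟ᵥ v = Dec.map′ enc-injective (cong enc) (enc u Fin.≟ enc v)

  up : V → Maybe V
  up root           = nothing
  up (at i zero)    = just root
  up (at i (suc j)) = just (at i (parent j))

  Tree : Rel V 0ℓ
  Tree u v = up u ≡ just v ⊎ up v ≡ just u

  -- Preorder puts a parent before its children, so the position in the gadget serves as the rank in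
  -- `parent⇒tree`.
  level : V → ℕ
  level root     = 0
  level (at _ j) = suc (toℕ j)

  up-level : ∀ {u v} → up u ≡ just v → level v < level u
  up-level {at i zero}    refl = s≤s z≤n
  up-level {at i (suc j)} refl = s≤s (s≤s (parent≤ j))

  level≤10 : ∀ u → level u ≤ 10
  level≤10 root     = z≤n
  level≤10 (at i j) = Fin.toℕ<n j

  has-up : ∀ u → u ≡ root ⊎ ∃ λ v → up u ≡ just v
  has-up root           = inj₁ refl
  has-up (at i zero)    = inj₂ (_ , refl)
  has-up (at i (suc j)) = inj₂ (_ , refl)

  tree? : ∀ u v → Dec (Tree u v)
  tree? u v = (up u ≟ₘ just v) ⊎-dec (up v ≟ₘ just u)
    where _≟ₘ_ = Maybe.≡-dec _≟ᵥ_

  T : Graph n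
  T = record
    { Adj    = λ x y → Tree (dec x) (dec y)
    ; adj?   = λ x y → tree? (dec x) (dec y)
    ; sym    = Sum.swap
    ; irrefl = λ { refl → [ ℕ.<-irrefl refl ∘ up-level , ℕ.<-irrefl refl ∘ up-level ]′ }
    }

  T-tree : IsTree T
  T-tree = parent⇒tree T {Up = λ x y → up (dec x) ≡ just (dec y)} id inj₁
    (λ {x} {y} {z} xy xz → trans (sym (enc-dec y)) (trans (cong enc (Maybe.just-injective (trans (sym xy) xz))) (enc-dec z)))
    (level ∘ dec) up-level (level≤10 ∘ dec) {r = enc root}
    λ x → Sum.map (λ eq → trans (sym (enc-dec x)) (cong enc eq))
                  (λ (v , eq) → enc v , trans eq (cong just (sym (dec-enc v)))) (has-up (dec x))

  nbrs : V → List V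
  nbrs root           = map (λ i → at i b₀) (allFin g)
  nbrs (at i zero)    = root ∷ map (at i) (local zero)
  nbrs (at i (suc j)) = map (at i) (local (suc j))

  local⊆nbrs : ∀ {i j k} → k L.∈ local j → at i k L.∈ nbrs (at i j)
  local⊆nbrs {j = zero}  k∈ = there (L.∈-map⁺ (at _) k∈)
  local⊆nbrs {j = suc j} k∈ = L.∈-map⁺ (at _) k∈

  up∈nbrs : ∀ u {v} → up u ≡ just v → v L.∈ nbrs u
  up∈nbrs (at i zero)    refl = here refl
  up∈nbrs (at i (suc j)) refl = local⊆nbrs {j = suc j} (parent∈local j)

  child∈nbrs : ∀ v {u} → up v ≡ just u → v L.∈ nbrs u
  child∈nbrs (at i zero)    refl = L.∈-map⁺ (λ i → at i b₀) (L.∈-allFin i)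
  child∈nbrs (at i (suc j)) refl = local⊆nbrs {j = parent j} (child∈local j)

  tree⇒∈nbrs : ∀ {u v} → Tree u v → v L.∈ nbrs u
  tree⇒∈nbrs {u} {v} = [ up∈nbrs u , child∈nbrs v ]′

  local⇒tree : ∀ {i j k} → k L.∈ local j → Tree (at i j) (at i k)
  local⇒tree {j = j} k∈ with All.lookup (local-tree j) k∈
  ... | inj₁ (_ , refl , refl) = inj₁ refl
  ... | inj₂ (_ , refl , refl) = inj₂ refl

  ∈nbrs⇒tree : ∀ u {v} → v L.∈ nbrs u → Tree u v
  ∈nbrs⇒tree root v∈ with L.∈-map⁻ (λ i → at i b₀) v∈
  ... | i , _ , refl = inj₂ refl
  ∈nbrs⇒tree (at i zero) (here refl) = inj₁ refl
  ∈nbrs⇒tree (at i zero) (there v∈) with L.∈-map⁻ (at i) v∈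
  ... | k , k∈ , refl = local⇒tree {j = zero} k∈
  ∈nbrs⇒tree (at i (suc j)) v∈ with L.∈-map⁻ (at i) v∈
  ... | k , k∈ , refl = local⇒tree {j = suc j} k∈

  nbrs-unique : ∀ u → Unique (nbrs u)
  nbrs-unique root           = Unique.map⁺ (λ { refl → refl }) (Unique.allFin⁺ g)
  nbrs-unique (at i zero)    = ((λ ()) ∷ (λ ()) ∷ []) ∷ Unique.map⁺ at-injective (local-unique zero)
  nbrs-unique (at i (suc j)) = Unique.map⁺ at-injective (local-unique (suc j))

  degree-T : ∀ x → degree T x ≡ length (nbrs (dec x))
  degree-T x = trans
    (degree≡length T {v = x} {us = map enc (nbrs (dec x))} (Unique.map⁺ enc-injective (nbrs-unique (dec x)))
      (λ {y} xy → subst (L._∈ map enc (nbrs (dec x))) (enc-dec y) (L.∈-map⁺ enc (tree⇒∈nbrs xy)))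
      (λ y∈ → case L.∈-map⁻ enc y∈ of λ where
        (v , v∈ , refl) → subst (Tree (dec x)) (sym (dec-enc v)) (∈nbrs⇒tree (dec x) v∈)))
    (List.length-map enc (nbrs (dec x)))

  LeafV : Pred V 0ℓ
  LeafV u = length (nbrs u) ≡ 1

  leafV? : ∀ u → Dec (LeafV u)
  leafV? u = length (nbrs u) ℕ.≟ 1

  leaf⁺ : ∀ {u} → LeafV u → Leaf T (enc u)
  leaf⁺ {u} leaf = trans (degree-T (enc u)) (trans (cong (length ∘ nbrs) (dec-enc u)) leaf)

  leaf⁻ : ∀ {x} → Leaf T x → LeafV (dec x)
  leaf⁻ {x} leaf = trans (sym (degree-T x)) leaf

  length-nbrs-root : length (nbrs root) ≡ g
  length-nbrs-root = trans (List.length-map _ (allFin g)) (List.length-tabulate id)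

  root-not-leaf : ¬ LeafV root
  root-not-leaf leaf = ℕ.<⇒≢ (ℕ.≤-trans (s≤s (s≤s z≤n)) 3≤g) (trans (sym leaf) length-nbrs-root)

  no-degree-2 : ∀ x → ¬ degree T x ≡ 2
  no-degree-2 x eq = go (dec x) (trans (sym (degree-T x)) eq)
    where
    go : ∀ u → ¬ length (nbrs u) ≡ 2
    go root           eq = ℕ.<⇒≢ 3≤g (trans (sym eq) length-nbrs-root)
    go (at i (suc j)) eq = local-no-degree-2 j (trans (sym (List.length-map (at i) (local (suc j)))) eq)

  three-leaves : 3 ≤ length (leaves T)
  three-leaves = unique⊆⇒length≤ (Unique.map⁺ enc-injective us!) us⊆
    where
    i₀ : Fin g
    i₀ = Fin.fromℕ< (ℕ.≤-trans (s≤s z≤n) 3≤g)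
    us : List V
    us = at i₀ ℓ₁ ∷ at i₀ ℓ₂ ∷ at i₀ ℓ₃ ∷ []
    us! : Unique us
    us! = ((λ ()) ∷ (λ ()) ∷ []) ∷ ((λ ()) ∷ []) ∷ [] ∷ []
    us-leaves : All LeafV us
    us-leaves = refl ∷ refl ∷ refl ∷ []
    us⊆ : ∀ {x} → x L.∈ map enc us → x L.∈ leaves T
    us⊆ x∈ with L.∈-map⁻ enc x∈
    ... | u , u∈ , refl = L.∈-filter⁺ (leaf? T) (L.∈-allFin (enc u)) (leaf⁺ {u} (All.lookup us-leaves u∈))

-- The plane embedding of the family and its leaf cycle

module FamilyHalin (g : ℕ) (3≤g : 3 ≤ g) where
  open Family g 3≤g

  rot : V → V → V
  rot root           (at i zero)    = at (rotate i) zero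
  rot (at i zero)    root           = at i ℓ₁
  rot (at i zero)    (at _ ℓ₁)      = at i p₀
  rot (at i zero)    (at _ p₀)      = root
  rot (at i (suc j)) (at _ k)       = at i (turn (suc j) k)
  rot _              v              = v

  rot-closed : ∀ u {v} → v L.∈ nbrs u → rot u v L.∈ nbrs u
  rot-closed root v∈ with L.∈-map⁻ (λ i → at i b₀) v∈
  ... | i , _ , refl = L.∈-map⁺ (λ i → at i b₀) (L.∈-allFin (rotate i))
  rot-closed (at i zero) (here refl)                 = there (here refl)
  rot-closed (at i zero) (there (here refl))         = there (there (here refl))
  rot-closed (at i zero) (there (there (here refl))) = here refl
  rot-closed (at i (suc j)) v∈ with L.∈-map⁻ (at i) v∈
  ... | k , k∈ , refl = L.∈-map⁺ (at i) (All.lookup (turn-local (suc j)) k∈)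

  fold-root : ∀ i k → fold (at i zero) (rot root) k ≡ at (fold i rotate k) zero
  fold-root i zero    = refl
  fold-root i (suc k) = cong (rot root) (fold-root i k)

  fold-local : ∀ i j u k → fold (at i u) (rot (at i (suc j))) k ≡ at i (fold u (turn (suc j)) k)
  fold-local i j u zero    = refl
  fold-local i j u (suc k) = cong (rot (at i (suc j))) (fold-local i j u k)

  rot-cyclic : ∀ u {v w} → v L.∈ nbrs u → w L.∈ nbrs u → Reaches (rot u) v w
  rot-cyclic root v∈ w∈ with L.∈-map⁻ (λ i → at i b₀) v∈ | L.∈-map⁻ (λ i → at i b₀) w∈
  ... | i , _ , refl | i′ , _ , refl with rotate-reaches i i′
  ... | k , eq = k , trans (fold-root i k) (cong (λ i → at i zero) eq)
  rot-cyclic (at i zero) (here refl)                 (here refl)                 = 0 , refl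
  rot-cyclic (at i zero) (here refl)                 (there (here refl))         = 1 , refl
  rot-cyclic (at i zero) (here refl)                 (there (there (here refl))) = 2 , refl
  rot-cyclic (at i zero) (there (here refl))         (here refl)                 = 2 , refl
  rot-cyclic (at i zero) (there (here refl))         (there (here refl))         = 0 , refl
  rot-cyclic (at i zero) (there (here refl))         (there (there (here refl))) = 1 , refl
  rot-cyclic (at i zero) (there (there (here refl))) (here refl)                 = 1 , refl
  rot-cyclic (at i zero) (there (there (here refl))) (there (here refl))         = 2 , refl
  rot-cyclic (at i zero) (there (there (here refl))) (there (there (here refl))) = 0 , refl
  rot-cyclic (at i (suc j)) v∈ w∈ with L.∈-map⁻ (at i) v∈ | L.∈-map⁻ (at i) w∈
  ... | u , u∈ , refl | u′ , u′∈ , refl with All.lookup (All.lookup (turn-cyclic j) u∈) u′∈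
  ... | k , eq = toℕ k , trans (fold-local i j u (toℕ k)) (cong (at i) eq)

  next : Fin n → Fin n → Fin n
  next x y = enc (rot (dec x) (dec y))

  fold-next : ∀ x y k → fold y (next x) k ≡ enc (fold (dec y) (rot (dec x)) k)
  fold-next x y zero    = sym (enc-dec y)
  fold-next x y (suc k) = cong (enc ∘ rot (dec x)) (trans (cong dec (fold-next x y k)) (dec-enc _))

  embedding : PlaneEmbedding T
  embedding = record
    { next   = next
    ; closed = λ {x} {y} xy → subst (Tree (dec x)) (sym (dec-enc _))
                 (∈nbrs⇒tree (dec x) (rot-closed (dec x) (tree⇒∈nbrs xy)))
    ; cyclic = λ {x} {y} {z} xy xz →
        let (k , eq) = rot-cyclic (dec x) (tree⇒∈nbrs xy) (tree⇒∈nbrs xz)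
        in k , trans (fold-next x y k) (trans (cong enc eq) (enc-dec z))
    }

  leaf-succ : V → V
  leaf-succ (at i ℓ₁) = at i ℓ₂
  leaf-succ (at i ℓ₂) = at i ℓ₃
  leaf-succ (at i ℓ₃) = at i ℓ₄
  leaf-succ (at i ℓ₄) = at i ℓ₅
  leaf-succ (at i ℓ₅) = at i ℓ₆
  leaf-succ (at i ℓ₆) = at i ℓ₇
  leaf-succ (at i ℓ₇) = at (rotate i) ℓ₁
  leaf-succ u         = u

  Succ : Rel V 0ℓ
  Succ u v = LeafV u × leaf-succ u ≡ v

  succ? : ∀ u v → Dec (Succ u v)
  succ? u v = leafV? u ×-dec (leaf-succ u ≟ᵥ v)

  succ-irrefl : ∀ u → ¬ Succ u u
  succ-irrefl root      (leaf , _) = root-not-leaf leaf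
  succ-irrefl (at i ℓ₁) (_ , ())
  succ-irrefl (at i ℓ₂) (_ , ())
  succ-irrefl (at i ℓ₃) (_ , ())
  succ-irrefl (at i ℓ₄) (_ , ())
  succ-irrefl (at i ℓ₅) (_ , ())
  succ-irrefl (at i ℓ₆) (_ , ())
  succ-irrefl (at i ℓ₇) (_ , ())

  -- On `V` the rotation reduces by computation, so boundary walks can be written out; `firstLeaf⁺`
  -- carries them to `Fin n`, where `enc` and `dec` are opaque.
  data FirstLeafV : (u v w : V) → Set where
    here  : ∀ {u v} → LeafV v → FirstLeafV u v v
    there : ∀ {u v w} → ¬ LeafV v → FirstLeafV v (rot v u) w → FirstLeafV u v w

  firstLeaf⁺ : ∀ {u v w} → FirstLeafV u v w → FirstLeaf T embedding (enc u) (enc v) (enc w)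
  firstLeaf⁺ (here {v = v} leaf) = here (leaf⁺ {v} leaf)
  firstLeaf⁺ (there {u} {v} {w} ¬leaf f) = there
    (λ leaf → ¬leaf (subst LeafV (dec-enc v) (leaf⁻ leaf)))
    (subst (λ x → FirstLeaf T embedding (enc v) (enc x) (enc w))
           (sym (cong₂ rot (dec-enc v) (dec-enc u))) (firstLeaf⁺ f))

  succ-walk : ∀ u → LeafV u → ∃[ v ] Tree u v × FirstLeafV u v (leaf-succ u)
  succ-walk root   leaf = contradiction leaf root-not-leaf
  succ-walk (at i ℓ₁) _ = at i b₀ , inj₁ refl , there (λ ()) (there (λ ()) (here refl))
  succ-walk (at i ℓ₂) _ = at i p₀ , inj₁ refl , there (λ ()) (here refl)
  succ-walk (at i ℓ₃) _ = at i p₀ , inj₁ refl , there (λ ()) (here refl)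
  succ-walk (at i ℓ₄) _ = at i p₀ , inj₁ refl , there (λ ()) (there (λ ()) (here refl))
  succ-walk (at i ℓ₅) _ = at i q₀ , inj₁ refl , there (λ ()) (here refl)
  succ-walk (at i ℓ₆) _ = at i q₀ , inj₁ refl , there (λ ()) (there (λ ()) (here refl))
  -- The boundary leaves the gadget through p₀, b₀ and the root, and reaches ℓ₁ of the next gadget
  -- through its b₀.
  succ-walk (at i ℓ₇) _ = at i p₀ , inj₁ refl ,
    there (λ ()) (there (λ ()) (there root-not-leaf (there (λ ()) (here refl))))

  succ⇒nextLeaf : ∀ {x y} → Succ (dec x) (dec y) → NextLeaf T embedding x y
  succ⇒nextLeaf {x} {y} (leaf , eq) with succ-walk (dec x) leaf
  ... | v , xv , f = subst (Leaf T) (enc-dec x) (leaf⁺ {dec x} leaf) , enc v ,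
    subst (Tree (dec x)) (sym (dec-enc v)) xv ,
    subst₂ (λ a b → FirstLeaf T embedding a (enc v) b) (enc-dec x) (trans (cong enc eq) (enc-dec y)) (firstLeaf⁺ f)

  firstLeaf-unique : ∀ {u v w w′} → FirstLeaf T embedding u v w → FirstLeaf T embedding u v w′ → w ≡ w′
  firstLeaf-unique (here _)     (here _)     = refl
  firstLeaf-unique (here leaf)  (there ¬l _) = contradiction leaf ¬l
  firstLeaf-unique (there ¬l _) (here leaf)  = contradiction leaf ¬l
  firstLeaf-unique (there _ f)  (there _ f′) = firstLeaf-unique f f′

  -- A leaf has only one tree neighbour to start from and the boundary walk is deterministic, so it
  -- ends where the walk of `succ-walk` does.
  nextLeaf⇒succ : ∀ {x y} → NextLeaf T embedding x y → Succ (dec x) (dec y)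
  nextLeaf⇒succ {x} {y} (leaf , v , xv , f)
    with succ⇒nextLeaf {x} {enc (leaf-succ (dec x))} (leaf⁻ leaf , sym (dec-enc _))
  ... | _ , v′ , xv′ , f′ with leaf-neighbour-unique T {x} leaf xv xv′
  ... | refl = leaf⁻ leaf , trans (sym (dec-enc _)) (cong dec (firstLeaf-unique f′ f))

  -- Cycle edges are given by the explicit successor, which is decidable, rather than by boundary
  -- walks.
  Edge : Rel V 0ℓ
  Edge u v = Tree u v ⊎ Succ u v ⊎ Succ v u

  G : Graph n
  G = record
    { Adj    = λ x y → Edge (dec x) (dec y)
    ; adj?   = λ x y → tree? (dec x) (dec y) ⊎-dec (succ? (dec x) (dec y) ⊎-dec succ? (dec y) (dec x))
    ; sym    = Sum.map Sum.swap Sum.swap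
    ; irrefl = λ { {x} refl → [ Graph.irrefl T {x} refl , [ succ-irrefl (dec x) , succ-irrefl (dec x) ]′ ]′ }
    }

  halin : IsHalin G
  halin = record
    { T           = T
    ; tree        = T-tree
    ; noDegree2   = no-degree-2
    ; threeLeaves = three-leaves
    ; embedding   = embedding
    ; edges       = λ x y → mk⇔
        (Sum.map₂ (Sum.map succ⇒nextLeaf succ⇒nextLeaf))
        (Sum.map₂ (Sum.map nextLeaf⇒succ nextLeaf⇒succ))
    }

-- Bounds for the gadget family

-- Every edge inside a gadget is listed at exactly one of its endpoints.
targets : Fin 10 → List (Fin 10)
targets b₀ = []
targets ℓ₁ = b₀ ∷ ℓ₂ ∷ []
targets p₀ = b₀ ∷ []
targets ℓ₂ = p₀ ∷ ℓ₃ ∷ []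
targets ℓ₃ = p₀ ∷ ℓ₄ ∷ []
targets ℓ₄ = p₀ ∷ ℓ₅ ∷ []
targets q₀ = p₀ ∷ []
targets ℓ₅ = q₀ ∷ ℓ₆ ∷ []
targets ℓ₆ = q₀ ∷ ℓ₇ ∷ []
targets ℓ₇ = p₀ ∷ []

Covers : Subset 10 → Set
Covers Y = ∀ k → All (λ j → k ∈ Y ⊎ j ∈ Y) (targets k)

covers? : ∀ Y → Dec (Covers Y)
covers? Y = Fin.all? λ k → All.all? (λ j → (k ∈? Y) ⊎-dec (j ∈? Y)) (targets k)

X : Subset 10
X = outside ∷ inside ∷ inside ∷ outside ∷ inside ∷ outside ∷ outside ∷ inside ∷ inside ∷ outside ∷ []

_≟ₛ_ : ∀ {n} (p q : Subset n) → Dec (p ≡ q)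
_≟ₛ_ = Vec.≡-dec Bool._≟_

Near : Fin 10 → Fin 10 → Set
Near k j = k ≡ j ⊎ j L.∈ targets k ⊎ k L.∈ targets j

near? : ∀ k j → Dec (Near k j)
near? k j = (k Fin.≟ j) ⊎-dec ((j ∈ₗ? targets k) ⊎-dec (k ∈ₗ? targets j))

-- The positions of X from which a guard can reach j.
sources : Fin 10 → List (Fin 10)
sources j = filter (λ k → near? k j ×-dec (k ∈? X)) (allFin 10)

abstract

  X-covers : Covers X
  X-covers = from-yes (covers? X)

  -- The check is exhaustive; by hand, leaving out p₀ costs its six neighbours. With p₀ taken, the
  -- edges b₀ℓ₁ and ℓ₂ℓ₃ and the triangle q₀ℓ₅ℓ₆ use up the other four vertices, so ℓ₄ and ℓ₇ are
  -- out. This forces ℓ₃, ℓ₅ and ℓ₆; then ℓ₂ is out and ℓ₁ is in.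
  X-minimum : ∀ {Y} → Covers Y → ∣ Y ∣ < 6 → Y ≡ X
  X-minimum {Y} = All.lookup
    (from-yes (All.all? (λ Y → covers? Y →-dec ((∣ Y ∣ ℕ.<? 6) →-dec (Y ≟ₛ X))) (subsets 10))) (∈-subsets Y)

  parent∈targets : ∀ j → parent j L.∈ targets (suc j)
  parent∈targets = from-yes (Fin.all? λ j → parent j ∈ₗ? targets (suc j))

module FamilyBounds (g : ℕ) (3≤g : 3 ≤ g) where
  open Family g 3≤g
  open FamilyHalin g 3≤g

  targets⇒edge : ∀ {i k j} → j L.∈ targets k → Edge (at i k) (at i j)
  targets⇒edge {k = ℓ₁} (here refl)         = inj₁ (inj₁ refl)
  targets⇒edge {k = ℓ₁} (there (here refl)) = inj₂ (inj₁ (refl , refl))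
  targets⇒edge {k = p₀} (here refl)         = inj₁ (inj₁ refl)
  targets⇒edge {k = ℓ₂} (here refl)         = inj₁ (inj₁ refl)
  targets⇒edge {k = ℓ₂} (there (here refl)) = inj₂ (inj₁ (refl , refl))
  targets⇒edge {k = ℓ₃} (here refl)         = inj₁ (inj₁ refl)
  targets⇒edge {k = ℓ₃} (there (here refl)) = inj₂ (inj₁ (refl , refl))
  targets⇒edge {k = ℓ₄} (here refl)         = inj₁ (inj₁ refl)
  targets⇒edge {k = ℓ₄} (there (here refl)) = inj₂ (inj₁ (refl , refl))
  targets⇒edge {k = q₀} (here refl)         = inj₁ (inj₁ refl)
  targets⇒edge {k = ℓ₅} (here refl)         = inj₁ (inj₁ refl)
  targets⇒edge {k = ℓ₅} (there (here refl)) = inj₂ (inj₁ (refl , refl))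
  targets⇒edge {k = ℓ₆} (here refl)         = inj₁ (inj₁ refl)
  targets⇒edge {k = ℓ₆} (there (here refl)) = inj₂ (inj₁ (refl , refl))
  targets⇒edge {k = ℓ₇} (here refl)         = inj₁ (inj₁ refl)

  succ⇒near : ∀ {i j} u → Succ u (at i j) → j ≢ ℓ₁ → ∃[ k ] u ≡ at i k × j L.∈ targets k
  succ⇒near root      (leaf , _) _ = contradiction leaf root-not-leaf
  succ⇒near (at i ℓ₁) (_ , refl) _ = ℓ₁ , refl , there (here refl)
  succ⇒near (at i ℓ₂) (_ , refl) _ = ℓ₂ , refl , there (here refl)
  succ⇒near (at i ℓ₃) (_ , refl) _ = ℓ₃ , refl , there (here refl)
  succ⇒near (at i ℓ₄) (_ , refl) _ = ℓ₄ , refl , there (here refl)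
  succ⇒near (at i ℓ₅) (_ , refl) _ = ℓ₅ , refl , there (here refl)
  succ⇒near (at i ℓ₆) (_ , refl) _ = ℓ₆ , refl , there (here refl)
  succ⇒near (at i ℓ₇) (_ , refl) j≢ℓ₁ = contradiction refl j≢ℓ₁

  near-succ : ∀ {i u} j → Succ (at i j) u → j ≢ ℓ₇ → ∃[ k ] u ≡ at i k × k L.∈ targets j
  near-succ ℓ₁ (_ , refl) _ = ℓ₂ , refl , there (here refl)
  near-succ ℓ₂ (_ , refl) _ = ℓ₃ , refl , there (here refl)
  near-succ ℓ₃ (_ , refl) _ = ℓ₄ , refl , there (here refl)
  near-succ ℓ₄ (_ , refl) _ = ℓ₅ , refl , there (here refl)
  near-succ ℓ₅ (_ , refl) _ = ℓ₆ , refl , there (here refl)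
  near-succ ℓ₆ (_ , refl) _ = ℓ₇ , refl , there (here refl)
  near-succ ℓ₇ _ j≢ℓ₇ = contradiction refl j≢ℓ₇

  -- The vertices of a gadget other than these three have no neighbours outside it.
  Inner : Fin 10 → Set
  Inner j = j ≢ b₀ × j ≢ ℓ₁ × j ≢ ℓ₇

  edge⇒near : ∀ {u i j} → Inner j → Edge u (at i j) → ∃[ k ] u ≡ at i k × Near k j
  edge⇒near {u} {i} {j} (j≢b₀ , j≢ℓ₁ , j≢ℓ₇) = λ where
      (inj₁ (inj₁ eq)) → case up-near u eq of λ (k , eq , k∈) → k , eq , inj₂ (inj₁ k∈)
      (inj₁ (inj₂ eq)) → case near-up j eq j≢b₀ of λ (k , eq , k∈) → k , eq , inj₂ (inj₂ k∈)
      (inj₂ (inj₁ s))  → case succ⇒near u s j≢ℓ₁ of λ (k , eq , k∈) → k , eq , inj₂ (inj₁ k∈)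
      (inj₂ (inj₂ s))  → case near-succ j s j≢ℓ₇ of λ (k , eq , k∈) → k , eq , inj₂ (inj₂ k∈)
    where
    up-near : ∀ {i j} u → up u ≡ just (at i j) → ∃[ k ] u ≡ at i k × j L.∈ targets k
    up-near (at i (suc k)) refl = suc k , refl , parent∈targets k
    near-up : ∀ {i u} j → up (at i j) ≡ just u → j ≢ b₀ → ∃[ k ] u ≡ at i k × k L.∈ targets j
    near-up zero    _    j≢b₀ = contradiction refl j≢b₀
    near-up (suc j) refl _    = parent j , refl , parent∈targets j

  edge-adj : ∀ {u v} → Edge u v → Adj G (enc u) (enc v)
  edge-adj {u} {v} = subst₂ Edge (sym (dec-enc u)) (sym (dec-enc v))

  ∈-gadget : ∀ {S i j} → enc (at i j) ∈ S ⇔ j ∈ gadget S i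
  ∈-gadget {S} {i} {j} = mk⇔
    (λ x∈ → Vec.lookup⇒[]= j _ (trans eq (Vec.[]=⇒lookup x∈)))
    (λ j∈ → Vec.lookup⇒[]= _ S (trans (sym eq) (Vec.[]=⇒lookup j∈)))
    where
    eq : lookup (gadget S i) j ≡ lookup S (enc (at i j))
    eq = Vec.lookup∘tabulate (λ j → lookup S (enc (at i j))) j

  gadget-cover : ∀ {S} → VertexCover G S → ∀ i → Covers (gadget S i)
  gadget-cover cover i k = All.tabulate λ j∈ → Sum.map (Equivalence.to ∈-gadget) (Equivalence.to ∈-gadget)
    (cover _ _ (edge-adj (targets⇒edge j∈)))

  -- After an attack on p₀ℓ₇ the guards of ℓ₃, ℓ₅ and ℓ₆ are left to cover the inner
  -- edges, and guards from outside the gadget do not arrive there in time.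
  module _ {C C′ : Subset n} {i : Fin g} (C≡X : gadget C i ≡ X) (cover′ : VertexCover G C′)
           (D : Defence G C C′ (enc (at i p₀)) (enc (at i ℓ₇))) where
    open Defence D

    Moves : Fin 10 → Fin 10 → Set
    Moves k j = φ (enc (at i k)) ≡ enc (at i j)

    moves-functional : ∀ {k j j′} → Moves k j → Moves k j′ → j ≡ j′
    moves-functional m m′ = at-injective (enc-injective (trans (sym m) m′))

    ∈X : ∀ {k} → enc (at i k) ∈ C → k ∈ X
    ∈X {k} = subst (k ∈_) C≡X ∘ Equivalence.to ∈-gadget

    -- All neighbours of an inner vertex lie in the gadget, so the guard that arrives there was in
    -- the gadget before, on a vertex of `X`.
    arrival : ∀ {j} → Inner j → enc (at i j) ∈ C′ → Any (λ k → Moves k j) (sources j)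
    arrival {j} inner j∈C′ with surjective j∈C′
    ... | w , w∈C , φw≡ with origin
      where
      origin : ∃[ k ] w ≡ enc (at i k) × Near k j
      origin with moves w∈C
      ... | inj₁ φw≡w = j , trans (sym φw≡w) φw≡ , inj₁ refl
      ... | inj₂ w~φw with edge⇒near {dec w} inner
              (subst (Edge (dec w)) (trans (cong dec φw≡) (dec-enc _)) w~φw)
      ... | k , eq , near = k , trans (sym (enc-dec w)) (cong enc eq) , near
    ... | k , refl , near =
      L.lose (L.∈-filter⁺ (λ k → near? k j ×-dec (k ∈? X)) (L.∈-allFin k) (near , ∈X w∈C)) φw≡

    p₀→ℓ₇ : Moves p₀ ℓ₇
    p₀→ℓ₇ with repels
    ... | inj₁ (_ , eq)   = eq
    ... | inj₂ (ℓ₇∈C , _) = contradiction (∈X ℓ₇∈C) (from-no (ℓ₇ ∈? X))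

    covered : ∀ k j → j L.∈ targets k → enc (at i k) ∈ C′ ⊎ enc (at i j) ∈ C′
    covered k j j∈ = cover′ _ _ (edge-adj (targets⇒edge j∈))

    clash : ∀ {k j j′} → j ≢ j′ → Moves k j → Moves k j′ → ⊥
    clash j≢j′ m m′ = j≢j′ (moves-functional m m′)

    -- `sources` evaluates to a list in vertex order. Where p₀ heads it, as here, that guard is
    -- excluded because it has gone to ℓ₇.
    to-p₀ : enc (at i p₀) ∈ C′ → Moves ℓ₃ p₀
    to-p₀ p₀∈C′ with arrival ((λ ()) , (λ ()) , (λ ())) p₀∈C′
    ... | here m         = ⊥-elim (clash (λ ()) m p₀→ℓ₇)
    ... | there (here m) = m

    to-ℓ₃ : enc (at i ℓ₃) ∈ C′ → Moves ℓ₃ ℓ₃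
    to-ℓ₃ ℓ₃∈C′ with arrival ((λ ()) , (λ ()) , (λ ())) ℓ₃∈C′
    ... | here m         = ⊥-elim (clash (λ ()) m p₀→ℓ₇)
    ... | there (here m) = m

    to-ℓ₄ : enc (at i ℓ₄) ∈ C′ → Moves ℓ₃ ℓ₄ ⊎ Moves ℓ₅ ℓ₄
    to-ℓ₄ ℓ₄∈C′ with arrival ((λ ()) , (λ ()) , (λ ())) ℓ₄∈C′
    ... | here m                 = ⊥-elim (clash (λ ()) m p₀→ℓ₇)
    ... | there (here m)         = inj₁ m
    ... | there (there (here m)) = inj₂ m

    to-q₀ : enc (at i q₀) ∈ C′ → Moves ℓ₅ q₀ ⊎ Moves ℓ₆ q₀
    to-q₀ q₀∈C′ with arrival ((λ ()) , (λ ()) , (λ ())) q₀∈C′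
    ... | here m                 = ⊥-elim (clash (λ ()) m p₀→ℓ₇)
    ... | there (here m)         = inj₁ m
    ... | there (there (here m)) = inj₂ m

    to-ℓ₅ : enc (at i ℓ₅) ∈ C′ → Moves ℓ₅ ℓ₅ ⊎ Moves ℓ₆ ℓ₅
    to-ℓ₅ ℓ₅∈C′ with arrival ((λ ()) , (λ ()) , (λ ())) ℓ₅∈C′
    ... | here m         = inj₁ m
    ... | there (here m) = inj₂ m

    to-ℓ₆ : enc (at i ℓ₆) ∈ C′ → Moves ℓ₅ ℓ₆ ⊎ Moves ℓ₆ ℓ₆
    to-ℓ₆ ℓ₆∈C′ with arrival ((λ ()) , (λ ()) , (λ ())) ℓ₆∈C′
    ... | here m         = inj₁ m
    ... | there (here m) = inj₂ m

    -- Otherwise ℓ₆ would have to guard the triangle q₀ℓ₅ℓ₆ alone.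
    ¬ℓ₅→ℓ₄ : ¬ Moves ℓ₅ ℓ₄
    ¬ℓ₅→ℓ₄ ℓ₅→ℓ₄ with covered ℓ₅ ℓ₆ (there (here refl))
    ... | inj₁ ℓ₅∈C′ with only-ℓ₆ (to-ℓ₅ ℓ₅∈C′) (λ ())
      where
      only-ℓ₆ : ∀ {j} → Moves ℓ₅ j ⊎ Moves ℓ₆ j → ℓ₄ ≢ j → Moves ℓ₆ j
      only-ℓ₆ (inj₁ m) ℓ₄≢j = ⊥-elim (clash ℓ₄≢j ℓ₅→ℓ₄ m)
      only-ℓ₆ (inj₂ m) _    = m
    ...   | ℓ₆→ℓ₅ with covered ℓ₆ q₀ (here refl)
    ...     | inj₁ ℓ₆∈C′ = [ clash (λ ()) ℓ₅→ℓ₄ , clash (λ ()) ℓ₆→ℓ₅ ]′ (to-ℓ₆ ℓ₆∈C′)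
    ...     | inj₂ q₀∈C′ = [ clash (λ ()) ℓ₅→ℓ₄ , clash (λ ()) ℓ₆→ℓ₅ ]′ (to-q₀ q₀∈C′)
    ¬ℓ₅→ℓ₄ ℓ₅→ℓ₄ | inj₂ ℓ₆∈C′ with to-ℓ₆ ℓ₆∈C′
    ...   | inj₁ ℓ₅→ℓ₆ = clash (λ ()) ℓ₅→ℓ₄ ℓ₅→ℓ₆
    ...   | inj₂ ℓ₆→ℓ₆ with covered ℓ₅ q₀ (here refl)
    ...     | inj₁ ℓ₅∈C′ = [ clash (λ ()) ℓ₅→ℓ₄ , clash (λ ()) ℓ₆→ℓ₆ ]′ (to-ℓ₅ ℓ₅∈C′)
    ...     | inj₂ q₀∈C′ = [ clash (λ ()) ℓ₅→ℓ₄ , clash (λ ()) ℓ₆→ℓ₆ ]′ (to-q₀ q₀∈C′)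

    ℓ₃-fixed : ¬ Moves ℓ₃ p₀ → Moves ℓ₃ ℓ₃
    ℓ₃-fixed ¬ℓ₃→p₀ with covered ℓ₃ p₀ (here refl)
    ... | inj₁ ℓ₃∈C′ = to-ℓ₃ ℓ₃∈C′
    ... | inj₂ p₀∈C′ = contradiction (to-p₀ p₀∈C′) ¬ℓ₃→p₀

    -- By `¬ℓ₅→ℓ₄` the guard of ℓ₃ is the only one that can end in the triangle p₀ℓ₃ℓ₄, and one
    -- vertex does not cover a triangle.
    undefendable : ⊥
    undefendable with covered ℓ₄ p₀ (here refl)
    ... | inj₁ ℓ₄∈C′ with to-ℓ₄ ℓ₄∈C′
    ...   | inj₁ ℓ₃→ℓ₄ = clash (λ ()) (ℓ₃-fixed (clash (λ ()) ℓ₃→ℓ₄)) ℓ₃→ℓ₄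
    ...   | inj₂ ℓ₅→ℓ₄ = ¬ℓ₅→ℓ₄ ℓ₅→ℓ₄
    undefendable | inj₂ p₀∈C′ with covered ℓ₃ ℓ₄ (there (here refl))
    ...   | inj₁ ℓ₃∈C′ = clash (λ ()) (to-p₀ p₀∈C′) (to-ℓ₃ ℓ₃∈C′)
    ...   | inj₂ ℓ₄∈C′ = [ clash (λ ()) (to-p₀ p₀∈C′) , ¬ℓ₅→ℓ₄ ]′ (to-ℓ₄ ℓ₄∈C′)

  -- Counting in a single configuration of the class is enough: a gadget with at most five guards
  -- would carry `X` and lose to an attack on p₀ℓ₇.
  evc≥6g : ∀ {k} → IsEvc G k → g * 6 ≤ k
  evc≥6g ((𝒞 , E) , _) with EvcClass.nonempty E
  ... | C , C∈𝒞 = subst (g * 6 ≤_) (EvcClass.size E C∈𝒞) (gadgets-≤ C six)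
    where
    six : ∀ i → 6 ≤ ∣ gadget C i ∣
    six i with 6 ℕ.≤? ∣ gadget C i ∣
    ... | yes 6≤ = 6≤
    ... | no 6≰ with EvcClass.defends E C∈𝒞 (enc (at i p₀)) (enc (at i ℓ₇)) (edge-adj (inj₁ (inj₂ refl)))
    ... | C′ , C′∈𝒞 , D = ⊥-elim (undefendable
      (X-minimum (gadget-cover (EvcClass.covers E C∈𝒞) i) (ℕ.≰⇒> 6≰)) (EvcClass.covers E C′∈𝒞) D)

  copies-cover : VertexCover G (copies X)
  copies-cover x y xy = Sum.map (subst (_∈ copies X) (enc-dec x)) (subst (_∈ copies X) (enc-dec y)) (go xy)
    where
    Covered : V → Set
    Covered u = enc u ∈ copies X
    covered-root : Covered root
    covered-root = Vec.lookup⇒[]= _ (copies X) (lookup-copies-root X)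
    covered-at : ∀ {i j} → j ∈ X → Covered (at i j)
    covered-at {i} {j} j∈X = Vec.lookup⇒[]= _ (copies X) (trans (lookup-copies X i j) (Vec.[]=⇒lookup j∈X))
    covered-up : ∀ u {v} → up u ≡ just v → Covered u ⊎ Covered v
    covered-up (at i zero)    refl = inj₂ covered-root
    covered-up (at i (suc j)) refl =
      Sum.map covered-at covered-at (All.lookup (X-covers (suc j)) (parent∈targets j))
    covered-succ : ∀ u {v} → Succ u v → Covered u ⊎ Covered v
    covered-succ root      (leaf , _) = contradiction leaf root-not-leaf
    -- The edge to the next gadget is covered at its far end, by the vertex ℓ₁ there.
    covered-succ (at i ℓ₇) (_ , refl) = inj₂ (covered-at (from-yes (ℓ₁ ∈? X)))
    covered-succ (at i ℓ₁) (_ , refl) = inj₁ (covered-at (from-yes (ℓ₁ ∈? X)))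
    covered-succ (at i ℓ₂) (_ , refl) = inj₂ (covered-at (from-yes (ℓ₃ ∈? X)))
    covered-succ (at i ℓ₃) (_ , refl) = inj₁ (covered-at (from-yes (ℓ₃ ∈? X)))
    covered-succ (at i ℓ₄) (_ , refl) = inj₂ (covered-at (from-yes (ℓ₅ ∈? X)))
    covered-succ (at i ℓ₅) (_ , refl) = inj₁ (covered-at (from-yes (ℓ₅ ∈? X)))
    covered-succ (at i ℓ₆) (_ , refl) = inj₁ (covered-at (from-yes (ℓ₆ ∈? X)))
    go : ∀ {u v} → Edge u v → Covered u ⊎ Covered v
    go {u} {v} (inj₁ (inj₁ eq)) = covered-up u eq
    go {u} {v} (inj₁ (inj₂ eq)) = Sum.swap (covered-up v eq)
    go {u} {v} (inj₂ (inj₁ s))  = covered-succ u s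
    go {u} {v} (inj₂ (inj₂ s))  = Sum.swap (covered-succ v s)

  mvc≤1+5g : ∀ {m} → IsMvc G m → m ≤ suc (g * 5)
  mvc≤1+5g (_ , min) = subst (_ ≤_) (∣copies∣ X) (min _ (copies X , copies-cover , refl))

  mvc-nonZero : ∀ {m} → IsMvc G m → NonZero m
  mvc-nonZero {suc _} _ = _
  mvc-nonZero {zero} ((S , cover , ∣S∣≡0) , _) =
    [ nonempty , nonempty ]′ (cover _ _ (edge-adj {root} {at i₀ zero} (inj₁ (inj₂ refl))))
    where
    i₀ : Fin g
    i₀ = Fin.fromℕ< (ℕ.≤-trans (s≤s z≤n) 3≤g)
    nonempty : ∀ {x} → x ∈ S → NonZero 0
    nonempty x∈S = contradiction (unique⇒length≤∣∣ ([] ∷ []) λ { (here refl) → x∈S })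
      (ℕ.<⇒≱ (ℕ.≤-reflexive (cong suc ∣S∣≡0)))

ratio≥7/6 : ∀ {g} → 7 ≤ g → (3≤g : 3 ≤ g) → RatioAtLeast (fromℚ (+ 7 / 6)) (_ , FamilyHalin.G g 3≤g)
ratio≥7/6 {g} 7≤g 3≤g =
  let open FamilyBounds g 3≤g
      (k , evc) = evc-exists (FamilyHalin.G g 3≤g)
      (m , mvc) = mvc-exists (FamilyHalin.G g 3≤g)
      m≢0 = mvc-nonZero mvc
  in k , m , evc , mvc , m≢0 , λ q<7/6 → ℚ.<-≤-trans q<7/6
       (cross⇒7/6≤ k m {{m≢0}} (7m≤6k (evc≥6g evc) (mvc≤1+5g mvc)))
  where
  open ℕ.≤-Reasoning
  7m≤6k : ∀ {k m} → g * 6 ≤ k → m ≤ suc (g * 5) → 7 * m ≤ 6 * k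
  7m≤6k {k} {m} 6g≤k m≤1+5g = begin
    7 * m           ≤⟨ ℕ.*-monoʳ-≤ 7 m≤1+5g ⟩
    7 * suc (g * 5) ≡⟨ ℕ.*-suc 7 (g * 5) ⟩
    -- The summand 7 stems from the root in the cover.
    7 + 7 * (g * 5) ≤⟨ ℕ.+-monoˡ-≤ _ 7≤g ⟩
    g + 7 * (g * 5) ≡⟨ solve 1 (λ g → g :+ con 7 :* (g :* con 5) := con 6 :* (g :* con 6)) refl g ⟩
    6 * (g * 6)     ≤⟨ ℕ.*-monoʳ-≤ 6 6g≤k ⟩
    6 * k           ∎
    where open +-*-Solver

≅⇒order≡ : ∀ {m n} {G : Graph m} {H : Graph n} → (m , G) ≅ (n , H) → m ≡ n
≅⇒order≡ (f , _) = Perm.↔⇒≡ f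

bounded-orders : ∀ (Gs : List FinGraph) → ∃[ N ] All (λ H → proj₁ H ≤ N) Gs
bounded-orders []             = 0 , []
bounded-orders ((n , _) ∷ Gs) with bounded-orders Gs
... | N , ≤N = n + N , ℕ.m≤m+n n N ∷ All.map (λ m≤N → ℕ.≤-trans m≤N (ℕ.m≤n+m N n)) ≤N

-- Isomorphic graphs have the same order, so a graph larger than every member of the list is new.
unbounded⇒infinitelyMany : ∀ {ℓ} {P : Pred FinGraph ℓ} →
                           (∀ N → ∃[ n ] Σ (Graph n) λ G → N < n × P (n , G)) → InfinitelyMany P
unbounded⇒infinitelyMany large Gs with bounded-orders Gs
... | N , ≤N with large N
... | n , G , N<n , PG = (n , G) , PG , All.map
  (λ {H} m≤N G≅H → ℕ.<⇒≢ (ℕ.≤-<-trans m≤N N<n) (sym (≅⇒order≡ {G = G} {proj₂ H} G≅H))) ≤N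

7/6≤ρ-Halin : rational (+ 7 / 6) ≤ₑ ρ Halin
7/6≤ρ-Halin q<7/6 = fromℚ (+ 7 / 6) , unbounded⇒infinitelyMany (λ N →
    let g = 7 + N
        7≤g = ℕ.m≤m+n 7 N
        3≤g = ℕ.≤-trans (s≤s (s≤s (s≤s z≤n))) 7≤g
    in _ , FamilyHalin.G g 3≤g , ℕ.≤-<-trans (ℕ.m≤n+m N 7) (Family.g<n g 3≤g) ,
       FamilyHalin.halin g 3≤g , ratio≥7/6 7≤g 3≤g)
  , q<7/6

mainTheorem1 : (rational (+ 7 / 6) ≤ₑ ρ Halin) × (ρ Halin ≤ₑ rational (+ 3 / 2))
mainTheorem1 = 7/6≤ρ-Halin , ρ-Halin≤3/2
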